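{- For every integer $k\ge 2$, there is an $O(n^4)$ time $2k$-approximation algorithm for UFPP restricted to instances in which every task is $\frac1k$-large, i.e. $d_i>\frac1k\,b(i)$ for every task $i$, where $n$ is the number of tasks.
   Context: UFPP (Unsplittable Flow Problem on a Path): an instance consists of a path $P=(V,E)$ with $V=\{0,\ldots,m\}$, $E=\{\{i,i+1\}\mid 0\le i\le m-1\}$, a positive integer capacity $u_e$ for each edge $e\in E$, and a set $T=\{1,\ldots,n\}$ of tasks, where task $i$ has a start vertex $s_i\in V$ and end vertex $t_i\in V$ with $s_i<t_i$, a positive integer demand $d_i$, and a positive integer profit $w_i$. Task $i$ uses edge $e$ if $e$ lies on the subpath from $s_i$ to $t_i$; $T_e$ is the set of tasks using $e$. A set $F\subseteq T$ is feasible if $\sum_{i\in F\cap T_e}d_i\le u_e$ for every $e\in E$. The goal is to find a feasible $F$ maximizing the profit $w(F)=\sum_{i\in F}w_i$. It is assumed that every vertex of $P$ is a start or end vertex of some task, so $m<2n$. The bottleneck capacity $b(i)$ of task $i$ is the minimum of $u_e$ over all edges $e$ used by $i$. For $0<\delta\le1$, task $i$ is $\delta$-small if $d_i\le\delta\cdot b(i)$, and $\delta$-large otherwise. An $\alpha$-approximation algorithm is an algorithm that computes, for every given instance, a feasible solution whose profit is at least $\frac1\alpha$ times the optimal profit. -}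

module Defs where

open import Data.Bool using (not; if_then_else_)
open import Data.Fin using (Fin; toℕ; fromℕ<)
open import Data.Fin.Properties using (toℕ≤pred[n])
open import Data.Fin.Subset using (Subset; _∩_)
open import Data.Integer using (+_)
open import Data.List using (map; filter; allFin)
open import Data.List.Extrema.Nat using (min)
open import Data.Nat using (ℕ; suc; _+_; _∸_; _*_; _≤_; _<_; _≟_; _≤?_; _<?_)
open import Data.Nat.Properties using (+-0-monoid; <-≤-trans)
open import Data.Product using (_×_; ∃-syntax)
open import Data.Rational.Unnormalised as ℚ using (ℚᵘ)
open import Data.Sum using (_⊎_)
open import Data.Vec using (lookup; tabulate)
open import Relation.Binary.PropositionalEquality using (_≡_; _≢_)
open import Relation.Nullary using (Dec; yes; no; does; ¬_)
open import Relation.Nullary.Decidable using (_×-dec_)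

open import Algebra.Properties.Monoid.Sum +-0-monoid using (sum-syntax)

------------------------------------------------------------------------
-- The unsplittable flow problem on a path

-- Tasks are numbered from 0.  The vertices are 0, …, numEdges, and
-- e : Fin numEdges stands for the edge {e , e + 1}.
record Instance : Set where
  field
    numEdges : ℕ
    numTasks : ℕ
    capacity : Fin numEdges → ℕ
    start    : Fin numTasks → Fin (suc numEdges)
    end      : Fin numTasks → Fin (suc numEdges)
    demand   : Fin numTasks → ℕ
    profit   : Fin numTasks → ℕ

    start<end  : ∀ i → toℕ (start i) < toℕ (end i)
    capacity>0 : ∀ e → 0 < capacity e
    demand>0   : ∀ i → 0 < demand i
    profit>0   : ∀ i → 0 < profit i

    -- The standing assumption that every vertex is an endpoint of a task.
    covered : ∀ v → ∃[ i ] (v ≡ start i ⊎ v ≡ end i)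

sumOver : ∀ {n} → Subset n → (Fin n → ℕ) → ℕ
sumOver {n} F f = ∑[ i < n ] (if lookup F i then f i else 0)

module _ (I : Instance) where
  open Instance I

  Uses : Fin numTasks → Fin numEdges → Set
  Uses i e = toℕ (start i) ≤ toℕ e × toℕ e < toℕ (end i)

  uses? : ∀ i e → Dec (Uses i e)
  uses? i e = (toℕ (start i) ≤? toℕ e) ×-dec (toℕ e <? toℕ (end i))

  tasksUsing : Fin numEdges → Subset numTasks
  tasksUsing e = tabulate (λ i → does (uses? i e))

  Feasible : Subset numTasks → Set
  Feasible F = ∀ e → sumOver (F ∩ tasksUsing e) demand ≤ capacity e

  totalProfit : Subset numTasks → ℕ
  totalProfit F = sumOver F profit

  IsOptimalProfit : ℕ → Set
  IsOptimalProfit p =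
    (∃[ F ] (Feasible F × totalProfit F ≡ p)) ×
    (∀ F → Feasible F → totalProfit F ≤ p)

  firstEdge : Fin numTasks → Fin numEdges
  firstEdge i = fromℕ< (<-≤-trans (start<end i) (toℕ≤pred[n] (end i)))

  -- `min x xs` is the minimum of x and the elements of xs; the first edge
  -- is itself used by i, so it does not affect the minimum.
  bottleneck : Fin numTasks → ℕ
  bottleneck i =
    min (capacity (firstEdge i))
        (map capacity (filter (uses? i) (allFin numEdges)))

  Small : ℚᵘ → Fin numTasks → Set
  Small δ i = (+ demand i ℚ./ 1) ℚ.≤ δ ℚ.* (+ bottleneck i ℚ./ 1)

  Large : ℚᵘ → Fin numTasks → Set
  Large δ i = ¬ Small δ i

  -- F is feasible and its profit is at least opt / α.
  IsApproximateSolution : ℕ → Subset numTasks → Set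
  IsApproximateSolution α F =
    Feasible F × (∀ opt → IsOptimalProfit opt → opt ≤ α * totalProfit F)

------------------------------------------------------------------------
-- The machine model

-- A unit-cost random access machine with addition and subtraction (and no
-- multiplication), presented as a structured language.  A program mentions
-- finitely many registers and finitely many one-dimensional arrays, both
-- named by numerals fixed in the program text; only array indices are
-- computed at run time.
record State : Set where
  constructor state
  field
    registers : ℕ → ℕ
    arrays    : ℕ → ℕ → ℕ

open State public

update : {A : Set} → (ℕ → A) → ℕ → A → ℕ → A
update f x a y = if does (y ≟ x) then a else f y

infixl 6 _⊕_ _⊖_

data Expr : Set where
  lit  : ℕ → Expr
  reg  : ℕ → Expr
  load : ℕ → Expr → Expr      -- array name, index
  _⊕_  : Expr → Expr → Expr
  _⊖_  : Expr → Expr → Expr   -- truncated subtraction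

eval : Expr → State → ℕ
eval (lit c)    σ = c
eval (reg x)    σ = registers σ x
eval (load a e) σ = arrays σ a (eval e σ)
eval (e ⊕ f)    σ = eval e σ + eval f σ
eval (e ⊖ f)    σ = eval e σ ∸ eval f σ

-- Evaluating an expression takes one time unit per node.
cost : Expr → ℕ
cost (lit c)    = 1
cost (reg x)    = 1
cost (load a e) = 1 + cost e
cost (e ⊕ f)    = 1 + cost e + cost f
cost (e ⊖ f)    = 1 + cost e + cost f

infix  5 _≔_ _[_]≔_
infixr 4 _⨾_

data Program : Set where
  skip           : Program
  _≔_            : ℕ → Expr → Program          -- register
  _[_]≔_         : ℕ → Expr → Expr → Program   -- array name, index
  _⨾_            : Program → Program → Program
  ifNonzero_⟨_∣_⟩ : Expr → Program → Program → Program
  whileNonzero_⟨_⟩ : Expr → Program → Program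

infix 3 ⟨_,_⟩⇓⟨_,_⟩

-- ⟨ P , σ ⟩⇓⟨ σ′ , t ⟩: started in σ, P halts in σ′ after t time units.
data ⟨_,_⟩⇓⟨_,_⟩ : Program → State → State → ℕ → Set where

  ⇓skip : ∀ {σ} → ⟨ skip , σ ⟩⇓⟨ σ , 1 ⟩

  ⇓assign : ∀ {x e σ} →
    ⟨ x ≔ e , σ ⟩⇓⟨ state (update (registers σ) x (eval e σ)) (arrays σ)
                  , 1 + cost e ⟩

  ⇓store : ∀ {a e f σ} →
    ⟨ a [ e ]≔ f , σ ⟩⇓⟨ state (registers σ)
                           (update (arrays σ) a
                             (update (arrays σ a) (eval e σ) (eval f σ)))
                       , 1 + cost e + cost f ⟩

  ⇓seq : ∀ {P Q σ σ′ σ″ t t′} →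
    ⟨ P , σ ⟩⇓⟨ σ′ , t ⟩ →
    ⟨ Q , σ′ ⟩⇓⟨ σ″ , t′ ⟩ →
    ⟨ P ⨾ Q , σ ⟩⇓⟨ σ″ , t + t′ ⟩

  ⇓if-nonzero : ∀ {e P Q σ σ′ t} →
    eval e σ ≢ 0 →
    ⟨ P , σ ⟩⇓⟨ σ′ , t ⟩ →
    ⟨ ifNonzero e ⟨ P ∣ Q ⟩ , σ ⟩⇓⟨ σ′ , 1 + cost e + t ⟩

  ⇓if-zero : ∀ {e P Q σ σ′ t} →
    eval e σ ≡ 0 →
    ⟨ Q , σ ⟩⇓⟨ σ′ , t ⟩ →
    ⟨ ifNonzero e ⟨ P ∣ Q ⟩ , σ ⟩⇓⟨ σ′ , 1 + cost e + t ⟩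

  ⇓while-zero : ∀ {e P σ} →
    eval e σ ≡ 0 →
    ⟨ whileNonzero e ⟨ P ⟩ , σ ⟩⇓⟨ σ , 1 + cost e ⟩

  ⇓while-nonzero : ∀ {e P σ σ′ σ″ t t′} →
    eval e σ ≢ 0 →
    ⟨ P , σ ⟩⇓⟨ σ′ , t ⟩ →
    ⟨ whileNonzero e ⟨ P ⟩ , σ′ ⟩⇓⟨ σ″ , t′ ⟩ →
    ⟨ whileNonzero e ⟨ P ⟩ , σ ⟩⇓⟨ σ″ , 1 + cost e + t + t′ ⟩

------------------------------------------------------------------------
-- Input, output and approximation algorithms

zeroExtend : ∀ {n} → (Fin n → ℕ) → ℕ → ℕ
zeroExtend {n} f j with j <? n
... | yes j<n = f (fromℕ< j<n)
... | no  _   = 0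

-- Everything that does not hold input is initially zero.
input : Instance → State
input I = state rs as
  where
  open Instance I

  rs : ℕ → ℕ
  rs 0 = numTasks
  rs 1 = numEdges
  rs _ = 0

  as : ℕ → ℕ → ℕ
  as 0 = zeroExtend capacity
  as 1 = zeroExtend (λ i → toℕ (start i))
  as 2 = zeroExtend (λ i → toℕ (end i))
  as 3 = zeroExtend demand
  as 4 = zeroExtend profit
  as _ = λ _ → 0

-- The computed set consists of the tasks with a nonzero entry in array 5.
output : ∀ n → State → Subset n
output n σ = tabulate (λ i → not (does (arrays σ 5 (toℕ i) ≟ 0)))

-- P is an α-approximation algorithm for the instances in 𝒞, running in
-- time O(f n) for n tasks.  Covered instances have at least one task, so
-- the bound can be required for every n.
IsApproximationAlgorithm :
  (α : ℕ) (𝒞 : Instance → Set) (f : ℕ → ℕ) → Program → Set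
IsApproximationAlgorithm α 𝒞 f P =
  ∃[ c ] ∀ (I : Instance) → 𝒞 I →
    let n = Instance.numTasks I in
    ∃[ σ ] ∃[ t ]
      ( ⟨ P , input I ⟩⇓⟨ σ , t ⟩
      × t ≤ c * f n
      × IsApproximateSolution I α (output n σ) )

{-# OPTIONS --safe #-}
module Submission where

-- Draw task i as the rectangle [s i , t i) × [ℓ i , b i) hanging from the capacity profile, where b i is its
-- bottleneck, ℓ i = b i − d i, and e i (its peak) is its leftmost bottleneck edge.  Disjoint rectangles
-- form a feasible set, and conversely a feasible set F of large tasks splits into 2k sets of disjoint rectangles:
--
-- * The other tasks of F that cover the peak of i and have b above ℓ i have total demand at most ℓ i, while
--   each has demand more than ℓ i / k; so there are fewer than k of them, and colouring greedily by
--   increasing b uses k colours.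
-- * Two intersecting rectangles of one colour class overlap without covering each other's peak.  Such pairs form
--   a forest: when a task v is inserted in order of decreasing b, no task already present covers the
--   peak of v, and v meets at most one task on either side.  Hence two more colours suffice.
--
-- A heaviest set of disjoint rectangles is found by dynamic programming over pairs of walls i, j: if q
-- is the lowest rectangle strictly between the peaks of i and j, no other rectangle covers the peak of q, so the
-- remaining ones lie between i and q or between q and j.  As m + 1 rounds over all i, j, q suffice and
-- m < 2n, this takes O(n⁴) steps.

-- One program serves every k: largeness enters only when the optimum is compared with the heaviest
-- set of disjoint rectangles. The machine has neither recursion nor multiplication. Row and plane
-- offsets are tabulated by repeated addition.
--
-- Correctness rests on binary trees, the type `Plan`. Soundness: at any time a table entry is the
-- weight of some plan, and plans are feasible. Completeness: after r rounds an entry is at least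
-- the weight of every plan of height at most r. Being only a lower bound on entries, the latter
-- survives updating the tables in place. A disjoint set has a plan whose height is at most the
-- distance between the peaks of its walls, since each level uses up a column; the outermost peaks
-- are m + 1 columns apart, whence the number of rounds.

open import Defs
open import Data.Bool as Bool using (Bool; true; false; if_then_else_; not; _∧_; _∨_; _xor_)
open import Data.Bool.Properties using (∨-zeroʳ)
open import Data.Fin as Fin using (Fin; zero; suc; toℕ; fromℕ<; join; splitAt)
open import Data.Fin.Properties using (toℕ<n; toℕ-injective; any?; ¬∀⟶∃¬; toℕ-fromℕ<; fromℕ<-toℕ; injective⇒≤; splitAt-join; toℕ≤pred[n])
open import Data.Fin.Subset using (_∩_)
open import Data.Integer as ℤ using (+≤+)
import Data.Integer.Properties as ℤₚ
open import Data.List using (allFin)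
open import Data.List.Extrema.Nat using (v≤min⁺)
import Data.List.Relation.Unary.All as All
import Data.List.Relation.Unary.All.Properties as Allₚ
open import Data.Nat using (ℕ; zero; suc; NonZero; _+_; _∸_; _*_; _^_; _⊔_; _≤_; _<_; z≤n; s≤s; s≤s⁻¹; _≤?_; _<?_; _≟_)
open import Data.Nat.Properties hiding (_≟_; _≤?_; _<?_)
open import Data.Product using (Σ; ∃; ∃-syntax; _×_; _,_; proj₁; proj₂)
open import Data.Rational.Unnormalised using (_/_; *≤*)
open import Data.Sum using (_⊎_; inj₁; inj₂; [_,_]′)
open import Data.Vec using (lookup)
open import Data.Vec.Properties using (lookup∘tabulate; lookup-zipWith)
open import Function using (_∘_)
open import Relation.Binary.PropositionalEquality using (_≡_; _≢_; refl; sym; trans; cong; cong₂; subst; subst₂)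
open import Relation.Nullary using (Dec; yes; no; does; ¬_; contradiction)
open import Relation.Nullary.Decidable using (_×-dec_; ¬?; dec-true; dec-false)
open import Algebra.Properties.Semiring.Sum +-*-semiring
  using (sum; sum-cong-≗; sum-replicate-zero; ∑-distrib-+; ∑-comm; *-distribˡ-sum)

-- Finite sums

sum-mono : ∀ {n} {f g : Fin n → ℕ} → (∀ i → f i ≤ g i) → sum f ≤ sum g
sum-mono {zero}  h = z≤n
sum-mono {suc n} h = +-mono-≤ (h zero) (sum-mono (h ∘ suc))

sum-zero : ∀ {n} {f : Fin n → ℕ} → (∀ i → f i ≡ 0) → sum f ≡ 0
sum-zero {n} h = trans (sum-cong-≗ h) (sum-replicate-zero n)

term≤sum : ∀ {n} (f : Fin n → ℕ) (i : Fin n) → f i ≤ sum f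
term≤sum f zero    = m≤m+n _ _
term≤sum f (suc i) = ≤-trans (term≤sum (f ∘ suc) i) (m≤n+m _ _)

sum-point : ∀ {n} (q : Fin n) (f : Fin n → ℕ) → sum (λ i → if does (i Fin.≟ q) then f i else 0) ≡ f q
sum-point {suc n} zero f = trans (cong (f zero +_) (sum-zero {n} (λ _ → refl))) (+-identityʳ _)
sum-point (suc q) f = trans (sum-cong-≗ step) (sum-point q (f ∘ suc))
  where
  step : ∀ i → (if does (suc i Fin.≟ suc q) then f (suc i) else 0) ≡ (if does (i Fin.≟ q) then f (suc i) else 0)
  step i with i Fin.≟ q
  ... | yes _ = refl
  ... | no  _ = refl

restrict : ∀ {n} → (Fin n → Bool) → (Fin n → ℕ) → Fin n → ℕ
restrict S f i = if S i then f i else 0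

sumOn : ∀ {n} → (Fin n → Bool) → (Fin n → ℕ) → ℕ
sumOn S f = sum (restrict S f)

restrict-true : ∀ {n} {S : Fin n → Bool} {f : Fin n → ℕ} {i : Fin n} → S i ≡ true → restrict S f i ≡ f i
restrict-true eq rewrite eq = refl

member≤sumOn : ∀ {n} (S : Fin n → Bool) (f : Fin n → ℕ) {i : Fin n} → S i ≡ true → f i ≤ sumOn S f
member≤sumOn S f {i} eq = subst (_≤ sumOn S f) (restrict-true {S = S} {f} eq) (term≤sum _ i)

colourClass : ∀ {n k} → (Fin n → Bool) → (Fin n → Fin k) → Fin k → Fin n → Bool
colourClass S c x i = S i ∧ does (c i Fin.≟ x)

sumOn-classes : ∀ {n k} (S : Fin n → Bool) (c : Fin n → Fin k) (f : Fin n → ℕ) →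
  sum (λ x → sumOn (colourClass S c x) f) ≡ sumOn S f
sumOn-classes {n} {k} S c f = trans (∑-comm (λ x i → restrict (colourClass S c x) f i)) (sum-cong-≗ inner)
  where
  inner : ∀ i → sum (λ x → restrict (colourClass S c x) f i) ≡ restrict S f i
  inner i with S i
  ... | false = sum-zero {k} (λ _ → refl)
  ... | true  = trans (sum-cong-≗ flip) (sum-point (c i) (λ _ → f i))
    where
    flip : ∀ x → (if does (c i Fin.≟ x) then f i else 0) ≡ (if does (x Fin.≟ c i) then f i else 0)
    flip x with c i Fin.≟ x | x Fin.≟ c i
    ... | yes _ | yes _ = refl
    ... | no  _ | no  _ = refl
    ... | yes p | no ¬p = contradiction (sym p) ¬p
    ... | no ¬p | yes p = contradiction (sym p) ¬p

maximal-term : ∀ {k} .{{_ : NonZero k}} (f : Fin k → ℕ) → ∃[ x ] sum f ≤ k * f x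
maximal-term {suc zero} f = zero , ≤-refl
maximal-term {suc (suc k)} f with maximal-term (f ∘ suc)
... | x , le with f zero ≤? f (suc x)
...   | yes p = suc x , +-mono-≤ p le
...   | no ¬p = zero , +-monoʳ-≤ (f zero) (≤-trans le (*-monoʳ-≤ (suc k) (<⇒≤ (≰⇒> ¬p))))

argmin : ∀ {n} (S : Fin n → Bool) (f : Fin n → ℕ) →
  (∀ x → S x ≡ false) ⊎ (∃[ q ] S q ≡ true × (∀ x → S x ≡ true → f q ≤ f x))
argmin {zero}  S f = inj₁ λ ()
argmin {suc n} S f with argmin (S ∘ suc) (f ∘ suc) | S zero in eq
... | inj₁ none | false = inj₁ λ { zero → eq ; (suc x) → none x }
... | inj₁ none | true  = inj₂ (zero , eq , λ
  { zero _ → ≤-refl ; (suc x) Sx → contradiction (trans (sym Sx) (none x)) λ () })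
... | inj₂ (q , Sq , least) | false = inj₂ (suc q , Sq , λ
  { zero Sx → contradiction (trans (sym Sx) eq) λ () ; (suc x) Sx → least x Sx })
... | inj₂ (q , Sq , least) | true with f zero ≤? f (suc q)
...   | yes p = inj₂ (zero , eq , λ { zero _ → ≤-refl ; (suc x) Sx → ≤-trans p (least x Sx) })
...   | no ¬p = inj₂ (suc q , Sq , λ { zero _ → <⇒≤ (≰⇒> ¬p) ; (suc x) Sx → least x Sx })

∧-true : ∀ {a b} → a ∧ b ≡ true → a ≡ true × b ≡ true
∧-true {true} {true} _ = refl , refl

does-true : ∀ {p} {P : Set p} (P? : Dec P) → does P? ≡ true → P
does-true (yes p) _ = p

-- Lexicographic order on quotients and remainders

lex-≤ : ∀ {N a a′ r r′} → r′ < N → a * N + r ≤ a′ * N + r′ → a ≤ a′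
lex-≤ {N} {a} {a′} {r} {r′} r′<N le with a ≤? a′
... | yes p = p
... | no ¬p = contradiction le (<⇒≱ (begin-strict
  a′ * N + r′  <⟨ +-monoʳ-< (a′ * N) r′<N ⟩
  a′ * N + N   ≡⟨ +-comm (a′ * N) N ⟩
  suc a′ * N   ≤⟨ *-monoˡ-≤ N (≰⇒> ¬p) ⟩
  a * N        ≤⟨ m≤m+n _ _ ⟩
  a * N + r    ∎))
  where open ≤-Reasoning

lex-≡ : ∀ {N a a′ r r′} → r < N → r′ < N → a * N + r ≡ a′ * N + r′ → a ≡ a′ × r ≡ r′
lex-≡ {N} {a} {a′} {r} {r′} r<N r′<N eq = a≡a′ ,
  +-cancelˡ-≡ (a * N) _ _ (trans eq (cong (λ z → z * N + r′) (sym a≡a′)))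
  where
  a≡a′ : a ≡ a′
  a≡a′ = ≤-antisym (lex-≤ {r = r} r′<N (≤-reflexive eq)) (lex-≤ {r = r′} r<N (≤-reflexive (sym eq)))

-- Rectangles under the capacity profile

record Tasks (n m : ℕ) (u : ℕ → ℕ) : Set where
  field
    s t d w e : Fin n → ℕ
    s≤e      : ∀ i → s i ≤ e i
    e<t      : ∀ i → e i < t i
    t≤m      : ∀ i → t i ≤ m
    d>0      : ∀ i → 0 < d i
    least    : ∀ i x → s i ≤ x → x < t i → u (e i) ≤ u x
    leftmost : ∀ i x → s i ≤ x → x < e i → u (e i) < u x

  b ℓ : Fin n → ℕ
  b i = u (e i)
  ℓ i = b i ∸ d i

  Covers : Fin n → ℕ → Set
  Covers i x = s i ≤ x × x < t i

  covers? : ∀ i x → Dec (Covers i x)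
  covers? i x = (s i ≤? x) ×-dec (x <? t i)

  through : (Fin n → Bool) → ℕ → Fin n → Bool
  through S x i = S i ∧ does (covers? i x)

  Packs : (Fin n → Bool) → Set
  Packs S = ∀ x → x < m → sumOn (through S x) d ≤ u x

  Disjoint : Fin n → Fin n → Set
  Disjoint i j = t i ≤ s j ⊎ t j ≤ s i ⊎ b i ≤ ℓ j ⊎ b j ≤ ℓ i

-- Splitting a feasible set of large tasks into 2k sets of disjoint rectangles

module Colouring {n m : ℕ} {u : ℕ → ℕ} (T : Tasks n m u) where
  open Tasks T

  -- The triple (bottleneck, peak, index) in lexicographic order, packed into one number because
  -- `e i < m` and `toℕ i < n`. Both colourings are built by induction along it. The index makes it
  -- injective; the peak as second component is what `cross⇒same` exploits.
  key : Fin n → ℕ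
  key i = (b i * m + e i) * n + toℕ i

  key-injective : ∀ {i j} → key i ≡ key j → i ≡ j
  key-injective {i} {j} eq = toℕ-injective (proj₂ (lex-≡ {n} {b i * m + e i} {b j * m + e j} (toℕ<n i) (toℕ<n j) eq))

  e<m : ∀ i → e i < m
  e<m i = ≤-trans (e<t i) (t≤m i)

  covers-peak : ∀ i → Covers i (e i)
  covers-peak i = s≤e i , e<t i

  key⇒be : ∀ {i j} → key i ≤ key j → b i * m + e i ≤ b j * m + e j
  key⇒be {i} {j} le = lex-≤ {n} {_} {_} {toℕ i} {toℕ j} (toℕ<n j) le

  key⇒b : ∀ {i j} → key i ≤ key j → b i ≤ b j
  key⇒b {i} {j} le = lex-≤ {m} {b i} {b j} {e i} {e j} (e<m j) (key⇒be le)

  key⇒e : ∀ {i j} → key i ≤ key j → b i ≡ b j → e i ≤ e j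
  key⇒e {i} {j} le eq = +-cancelˡ-≤ (b i * m) _ _
    (subst (λ z → b i * m + e i ≤ z * m + e j) (sym eq) (key⇒be le))

  cross⇒b : ∀ {i j} → Covers j (e i) → b j ≤ b i
  cross⇒b {i} {j} (p , q) = least j (e i) p q

  -- Covering the peak of i forces `b j ≤ b i`, so under this key order the bottlenecks agree and
  -- `e i ≤ e j`. If `e i` came strictly first, j would have it as an earlier bottleneck edge,
  -- although `e j` is its leftmost one.
  cross⇒same : ∀ {i j} → Covers j (e i) → key i ≤ key j → b i ≡ b j × e i ≡ e j
  cross⇒same {i} {j} cr le = eqb , eqe
    where
    eqb : b i ≡ b j
    eqb = ≤-antisym (key⇒b le) (cross⇒b cr)
    eqe : e i ≡ e j
    eqe with m≤n⇒m<n∨m≡n (key⇒e le eqb)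
    ... | inj₁ lt = contradiction (sym eqb) (<⇒≢ (leftmost j (e i) (proj₁ cr) lt))
    ... | inj₂ eq = eq

  module _ (F : Fin n → Bool) (packs : Packs F) where

    demand≤bottleneck : ∀ i → F i ≡ true → d i ≤ b i
    demand≤bottleneck i Fi = ≤-trans
      (member≤sumOn (through F (e i)) d (cong₂ _∧_ Fi (dec-true (covers? i (e i)) (covers-peak i))))
      (packs (e i) (e<m i))

    ℓ<b : ∀ i → F i ≡ true → ℓ i < b i
    ℓ<b i Fi = ∸-monoʳ-< (d>0 i) (demand≤bottleneck i Fi)

    -- Asymmetric: only j has to cover the other's peak. Then `b j ≤ b i`, so the top of j lies in
    -- the vertical range of i and the rectangles meet.
    Conflict : Fin n → Fin n → Set
    Conflict i j = F j ≡ true × j ≢ i × Covers j (e i) × ℓ i < b j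

    conflict? : ∀ i j → Dec (Conflict i j)
    conflict? i j = (F j Bool.≟ true) ×-dec ¬? (j Fin.≟ i) ×-dec covers? j (e i) ×-dec (ℓ i <? b j)

    -- `cross⇒same` leaves only tasks with a common peak and a common bottleneck, and for these the
    -- relation is symmetric.
    conflict-sym : ∀ {i j} → F i ≡ true → key i ≤ key j → Conflict i j → Conflict j i
    conflict-sym {i} {j} Fi le (Fj , j≢i , cr , _) with cross⇒same cr le
    ... | eqb , eqe = Fi , j≢i ∘ sym , subst (Covers i) eqe (covers-peak i) , subst (ℓ j <_) (sym eqb) (ℓ<b j Fj)

    conflicts : Fin n → Fin n → Bool
    conflicts i j = does (conflict? i j)

    -- The conflicting tasks and i itself all use the edge `e i` of capacity `b i`; beside `d i`
    -- there remains room for `ℓ i`.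
    conflict-demand : ∀ i → F i ≡ true → sumOn (conflicts i) d ≤ ℓ i
    conflict-demand i Fi = m+n≤o⇒m≤o∸n _ (begin
      sumOn (conflicts i) d + d i
        ≡⟨ cong (sumOn (conflicts i) d +_) (sum-point i d) ⟨
      sumOn (conflicts i) d + sum (λ j → if does (j Fin.≟ i) then d j else 0)
        ≡⟨ ∑-distrib-+ (restrict (conflicts i) d) _ ⟨
      sum (λ j → restrict (conflicts i) d j + (if does (j Fin.≟ i) then d j else 0))
        ≤⟨ sum-mono step ⟩
      sumOn (through F (e i)) d
        ≤⟨ packs (e i) (e<m i) ⟩
      b i ∎)
      where
      open ≤-Reasoning
      through-member : ∀ j → F j ≡ true → Covers j (e i) → restrict (through F (e i)) d j ≡ d j
      through-member j Fj cr = restrict-true {S = through F (e i)} {d} (cong₂ _∧_ Fj (dec-true (covers? j (e i)) cr))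
      split : ∀ j → (p : Dec (Conflict i j)) (q : Dec (j ≡ i)) →
        (if does p then d j else 0) + (if does q then d j else 0) ≤ restrict (through F (e i)) d j
      split j (no  _) (no  _) = z≤n
      split j (yes (_ , j≢i , _)) (yes j≡i) = contradiction j≡i j≢i
      split j (no  _) (yes refl) = ≤-reflexive (sym (through-member j Fi (covers-peak j)))
      split j (yes (Fj , _ , cr , _)) (no _) = ≤-reflexive (trans (+-identityʳ _) (sym (through-member j Fj cr)))
      step : ∀ j → restrict (conflicts i) d j + (if does (j Fin.≟ i) then d j else 0) ≤ restrict (through F (e i)) d j
      step j = split j (conflict? i j) (j Fin.≟ i)

    module _ (k : ℕ) .{{_ : NonZero k}} (large : ∀ i → F i ≡ true → b i < k * d i) where

      -- If every colour were taken, each colour class of conflicts would contain a task j with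
      -- `k * d j > b j > ℓ i`. Summing over the k classes contradicts `conflict-demand`; all
      -- demands are multiplied by k to avoid division.
      free-colour : (c : Fin n → Fin k) (i : Fin n) → F i ≡ true → ∃[ x ] (∀ j → Conflict i j → c j ≢ x)
      free-colour c i Fi with ¬∀⟶∃¬ k Used used? ¬all-used
        where
        Used : Fin k → Set
        Used x = ∃[ j ] (Conflict i j × c j ≡ x)
        used? : ∀ x → Dec (Used x)
        used? x = any? λ j → conflict? i j ×-dec (c j Fin.≟ x)
        ¬all-used : ¬ (∀ x → Used x)
        ¬all-used all-used = <-irrefl refl (begin-strict
          k * ℓ i                                   <⟨ *-monoʳ-< k ≤-refl ⟩
          k * suc (ℓ i)                             ≡⟨ sum-const {k} (suc (ℓ i)) ⟨
          sum {k} (λ _ → suc (ℓ i))                 ≤⟨ sum-mono each ⟩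
          sum (λ x → k * sumOn (class x) d)         ≡⟨ *-distribˡ-sum k (λ x → sumOn (class x) d) ⟨
          k * sum (λ x → sumOn (class x) d)         ≡⟨ cong (k *_) (sumOn-classes (conflicts i) c d) ⟩
          k * sumOn (conflicts i) d                 ≤⟨ *-monoʳ-≤ k (conflict-demand i Fi) ⟩
          k * ℓ i                                   ∎)
          where
          open ≤-Reasoning
          class : Fin k → Fin n → Bool
          class = colourClass (conflicts i) c
          sum-const : ∀ {k} a → sum {k} (λ _ → a) ≡ k * a
          sum-const {zero}  a = refl
          sum-const {suc k} a = cong (a +_) (sum-const {k} a)
          each : ∀ x → suc (ℓ i) ≤ k * sumOn (class x) d
          each x with all-used x
          ... | j , cf@(Fj , _ , _ , ℓ<bj) , cj≡x = begin
            suc (ℓ i)           ≤⟨ ℓ<bj ⟩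
            b j                 ≤⟨ <⇒≤ (large j Fj) ⟩
            k * d j             ≤⟨ *-monoʳ-≤ k (member≤sumOn (class x) d
                                     (cong₂ _∧_ (dec-true (conflict? i j) cf) (dec-true (c j Fin.≟ x) cj≡x))) ⟩
            k * sumOn (class x) d ∎
      ... | x , unused = x , λ j cf cj≡x → unused (j , cf , cj≡x)

      -- Greedy colouring by increasing key: a conflict of i with a task that comes later is mutual.
      colouring-below : Fin k → ∀ r → Σ (Fin n → Fin k) λ c → (∀ i j → F i ≡ true → key i < r → key j < key i → Conflict i j → c i ≢ c j)
      colouring-below x₀ zero    = (λ _ → x₀) , λ _ _ _ ()
      colouring-below x₀ (suc r) with colouring-below x₀ r | any? (λ v → (F v Bool.≟ true) ×-dec (key v ≟ r))
      ... | c , ok | no none = c , λ i j Fi i<sr → ok i j Fi (≤∧≢⇒< (s≤s⁻¹ i<sr) λ eq → none (i , Fi , eq))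
      ... | c , ok | yes (v , Fv , refl) = c′ , ok′
        where
        x : Fin k
        x = proj₁ (free-colour c v Fv)
        c′ : Fin n → Fin k
        c′ i = if does (i Fin.≟ v) then x else c i
        ok′ : ∀ i j → F i ≡ true → key i < suc (key v) → key j < key i → Conflict i j → c′ i ≢ c′ j
        ok′ i j Fi i≤v j<i cf eq with i Fin.≟ v | j Fin.≟ v
        ... | yes refl | yes refl = <-irrefl refl j<i
        ... | yes refl | no  _    = proj₂ (free-colour c v Fv) j cf (sym eq)
        ... | no  _    | yes refl = <⇒≱ j<i (s≤s⁻¹ i≤v)
        ... | no  i≢v  | no  _    = ok i j Fi (≤∧≢⇒< (s≤s⁻¹ i≤v) (i≢v ∘ key-injective)) j<i cf eq

  upper-bound : ∀ {n} (f : Fin n → ℕ) → ∃[ r ] (∀ i → f i < r)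
  upper-bound f = suc (sum f) , λ i → s≤s (term≤sum f i)

  Uncrossed : (Fin n → Bool) → Set
  Uncrossed S = ∀ i j → S i ≡ true → S j ≡ true → i ≢ j → Covers j (e i) → b j ≤ ℓ i

  uncrossed-class : (F : Fin n → Bool) → Packs F → ∀ k .{{_ : NonZero k}} → (∀ i → F i ≡ true → b i < k * d i) →
    (f : Fin n → ℕ) → ∃[ S ] (∀ i → S i ≡ true → F i ≡ true) × Uncrossed S × sumOn F f ≤ k * sumOn S f
  uncrossed-class F packs k@(suc _) large f with upper-bound key
  ... | r , key<r with colouring-below F packs k large zero r
  ...   | c , ok with maximal-term (λ x → sumOn (colourClass F c x) f)
  ...     | x , le = S , S⊆F , uncrossed , subst (_≤ k * sumOn S f) (sumOn-classes F c f) le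
    where
    S : Fin n → Bool
    S = colourClass F c x
    S⊆F : ∀ i → S i ≡ true → F i ≡ true
    S⊆F i = proj₁ ∘ ∧-true
    same : ∀ i j → S i ≡ true → S j ≡ true → c i ≡ c j
    same i j Si Sj = trans (does-true (c i Fin.≟ x) (proj₂ (∧-true Si))) (sym (does-true (c j Fin.≟ x) (proj₂ (∧-true Sj))))
    uncrossed : Uncrossed S
    uncrossed i j Si Sj i≢j cr with b j ≤? ℓ i
    ... | yes p = p
    ... | no ¬p with ≤-total (key i) (key j) | (S⊆F j Sj , i≢j ∘ sym , cr , ≰⇒> ¬p)
    -- `ok` separates a task only from earlier ones, so when i is the earlier of the two the
    -- conflict is reversed first.
    ...   | inj₁ le | cf = contradiction (same j i Sj Si)
      (ok j i (S⊆F j Sj) (key<r j) (≤∧≢⇒< le (i≢j ∘ key-injective)) (conflict-sym F packs (S⊆F i Si) le cf))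
    ...   | inj₂ le | cf = contradiction (same i j Si Sj)
      (ok i j (S⊆F i Si) (key<r i) (≤∧≢⇒< le (i≢j ∘ sym ∘ key-injective)) cf)

  -- The remaining overlaps of an uncrossed set: neither task covers the peak of the other.
  Clash : Fin n → Fin n → Set
  Clash i j = e i < s j × s j < t i × t i ≤ e j × ℓ i < b j × ℓ j < b i

  clash? : ∀ i j → Dec (Clash i j)
  clash? i j = (e i <? s j) ×-dec (s j <? t i) ×-dec (t i ≤? e j) ×-dec (ℓ i <? b j) ×-dec (ℓ j <? b i)

  ClashFree : (Fin n → Bool) → Set
  ClashFree S = ∀ i j → S i ≡ true → S j ≡ true → ¬ Clash i j

  xor-cancel : ∀ z {x y} → x xor z ≡ y xor z → x ≡ y
  xor-cancel true  {true}  {true}  _ = refl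
  xor-cancel true  {false} {false} _ = refl
  xor-cancel false {true}  {true}  _ = refl
  xor-cancel false {false} {false} _ = refl

  xor-not : ∀ x → x xor not x ≡ true
  xor-not true  = refl
  xor-not false = refl

  module _ (S : Fin n → Bool) (ℓ<b′ : ∀ i → S i ≡ true → ℓ i < b i) (uncrossed : Uncrossed S) where

    Later : Fin n → Fin n → Set
    Later v g = S g ≡ true × key v < key g

    later? : ∀ v g → Dec (Later v g)
    later? v g = (S g Bool.≟ true) ×-dec (key v <? key g)

    later⇒≢ : ∀ {v g} → Later v g → v ≢ g
    later⇒≢ (_ , lt) refl = <-irrefl refl lt

    -- A later g on neither side would cover the peak of v. Uncrossedness would put it below v, with
    -- `b g ≤ ℓ v < b v`, against `b v ≤ b g`.
    later-side : ∀ {v g} → S v ≡ true → Later v g → t g ≤ e v ⊎ e v < s g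
    later-side {v} {g} Sv lg@(Sg , lt) with t g ≤? e v | e v <? s g
    ... | yes p | _     = inj₁ p
    ... | no  _ | yes q = inj₂ q
    ... | no ¬p | no ¬q = contradiction (uncrossed v g Sv Sg (later⇒≢ lg) (≮⇒≥ ¬q , ≰⇒> ¬p))
      (<⇒≱ (<-≤-trans (ℓ<b′ v Sv) (key⇒b (<⇒≤ lt))))

    -- Clashing with v makes g reach beyond `s v`, hence beyond `e g′`; as its own peak comes no
    -- later than that, g covers the peak of g′. Uncrossedness then gives `b g ≤ ℓ g′ < b v ≤ b g`.
    left-clash-ordered : ∀ {v g g′} → Later v g → Later v g′ → Clash g v → Clash g′ v → e g ≤ e g′ → g ≡ g′
    left-clash-ordered {v} {g} {g′} (Sg , lt) (Sg′ , _) (_ , sv<tg , _) (eg′<sv , _ , _ , ℓg′<bv , _) le with g Fin.≟ g′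
    ... | yes eq = eq
    ... | no g≢g′ = contradiction
      (uncrossed g′ g Sg′ Sg (g≢g′ ∘ sym) (≤-trans (s≤e g) le , <-trans eg′<sv sv<tg))
      (<⇒≱ (<-≤-trans ℓg′<bv (key⇒b (<⇒≤ lt))))

    left-clash-unique : ∀ {v g g′} → Later v g → Later v g′ → Clash g v → Clash g′ v → g ≡ g′
    left-clash-unique {v} {g} {g′} lg lg′ cl cl′ with ≤-total (e g) (e g′)
    ... | inj₁ le = left-clash-ordered lg lg′ cl cl′ le
    ... | inj₂ le = sym (left-clash-ordered lg′ lg cl′ cl le)

    -- Mirror image: here g′ starts before `t v ≤ e g` and ends beyond `e g′ ≥ e g`, so it is g′
    -- that covers the peak of g.
    right-clash-ordered : ∀ {v g g′} → Later v g → Later v g′ → Clash v g → Clash v g′ → e g ≤ e g′ → g ≡ g′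
    right-clash-ordered {v} {g} {g′} (Sg , _) (Sg′ , lt′) (_ , _ , tv≤eg , _ , ℓg<bv) (_ , sg′<tv , _) le with g Fin.≟ g′
    ... | yes eq = eq
    ... | no g≢g′ = contradiction
      (uncrossed g g′ Sg Sg′ g≢g′ (≤-trans (<⇒≤ sg′<tv) tv≤eg , ≤-<-trans le (e<t g′)))
      (<⇒≱ (<-≤-trans ℓg<bv (key⇒b (<⇒≤ lt′))))

    right-clash-unique : ∀ {v g g′} → Later v g → Later v g′ → Clash v g → Clash v g′ → g ≡ g′
    right-clash-unique {v} {g} {g′} lg lg′ cl cl′ with ≤-total (e g) (e g′)
    ... | inj₁ le = right-clash-ordered lg lg′ cl cl′ le
    ... | inj₂ le = sym (right-clash-ordered lg′ lg cl′ cl le)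

    -- With at most one task to satisfy, a single bit z, flipping a whole side at once, gives that
    -- task the colour `true`, opposite to the `false` of the inserted task. A flip of the whole
    -- side keeps its colouring proper.
    normaliser : {P : Fin n → Set} → (∀ g → Dec (P g)) → (∀ {g g′} → P g → P g′ → g ≡ g′) →
      (c : Fin n → Bool) → ∃[ z ] (∀ g → P g → c g xor z ≡ true)
    normaliser P? unique c with any? P?
    ... | yes (g , Pg) = not (c g) , λ g′ Pg′ → subst (λ h → c h xor not (c g) ≡ true) (unique Pg Pg′) (xor-not (c g))
    ... | no  none     = false , λ g Pg → contradiction (g , Pg) none

    ProperFrom : ℕ → (Fin n → Bool) → Set
    ProperFrom r c = ∀ i j → S i ≡ true → S j ≡ true → r ≤ key i → r ≤ key j → Clash i j → c i ≢ c j

    -- The task v with key r splits the later tasks into those left and those right of its peak, and clashes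
    -- with at most one of each; both sides can be recoloured independently of one another.
    two-colouring-step : ∀ r → ∃ (ProperFrom (suc r)) → ∃ (ProperFrom r)
    two-colouring-step r (c , ok) with any? (λ v → (S v Bool.≟ true) ×-dec (key v ≟ r))
    ... | no none = c , λ i j Si Sj r≤i r≤j → ok i j Si Sj
      (≤∧≢⇒< r≤i λ eq → none (i , Si , sym eq)) (≤∧≢⇒< r≤j λ eq → none (j , Sj , sym eq))
    ... | yes (v , Sv , refl) = c′ , ok′
      where
      left : ∃[ z ] (∀ g → Later v g × Clash g v → c g xor z ≡ true)
      left = normaliser (λ g → later? v g ×-dec clash? g v)
        (λ { (l , p) (l′ , p′) → left-clash-unique l l′ p p′ }) c
      right : ∃[ z ] (∀ g → Later v g × Clash v g → c g xor z ≡ true)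
      right = normaliser (λ g → later? v g ×-dec clash? v g)
        (λ { (l , p) (l′ , p′) → right-clash-unique l l′ p p′ }) c
      c′ : Fin n → Bool
      c′ g = if does (g Fin.≟ v) then false else if does (t g ≤? e v) then c g xor proj₁ left else c g xor proj₁ right
      c′-v : c′ v ≡ false
      c′-v rewrite dec-true (v Fin.≟ v) refl = refl
      c′-left : ∀ {g} → g ≢ v → t g ≤ e v → c′ g ≡ c g xor proj₁ left
      c′-left {g} g≢v le rewrite dec-false (g Fin.≟ v) g≢v | dec-true (t g ≤? e v) le = refl
      c′-right : ∀ {g} → g ≢ v → e v < s g → c′ g ≡ c g xor proj₁ right
      c′-right {g} g≢v lt rewrite dec-false (g Fin.≟ v) g≢v
        | dec-false (t g ≤? e v) (<⇒≱ (<-trans lt (≤-<-trans (s≤e g) (e<t g)))) = refl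
      flip-side : ∀ z {i j} → c′ i ≡ c i xor z → c′ j ≡ c j xor z → c i ≢ c j → c′ i ≢ c′ j
      flip-side z ci cj ≢ eq = ≢ (xor-cancel z (trans (sym ci) (trans eq cj)))
      ok′ : ProperFrom (key v) c′
      ok′ i j Si Sj v≤i v≤j cl = split (i Fin.≟ v) (j Fin.≟ v)
        where
        later : ∀ {g} → S g ≡ true → key v ≤ key g → g ≢ v → Later v g
        later Sg v≤g g≢v = Sg , ≤∧≢⇒< v≤g (g≢v ∘ sym ∘ key-injective)
        split : Dec (i ≡ v) → Dec (j ≡ v) → c′ i ≢ c′ j
        split (yes refl) (yes refl) _ = contradiction (proj₁ cl) (≤⇒≯ (s≤e v))
        split (yes refl) (no j≢v) eq
          with () ← trans (sym c′-v) (trans eq (trans (c′-right j≢v (proj₁ cl)) (proj₂ right j (later Sj v≤j j≢v , cl))))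
        split (no i≢v) (yes refl) eq
          with () ← trans (sym c′-v) (trans (sym eq) (trans (c′-left i≢v (proj₁ (proj₂ (proj₂ cl)))) (proj₂ left i (later Si v≤i i≢v , cl))))
        split (no i≢v) (no j≢v) with later Si v≤i i≢v | later Sj v≤j j≢v
        ... | li | lj with later-side Sv li | later-side Sv lj
        ...   | inj₁ p | inj₁ q = flip-side (proj₁ left) (c′-left i≢v p) (c′-left j≢v q) (ok i j Si Sj (proj₂ li) (proj₂ lj) cl)
        ...   | inj₂ p | inj₂ q = flip-side (proj₁ right) (c′-right i≢v p) (c′-right j≢v q) (ok i j Si Sj (proj₂ li) (proj₂ lj) cl)
        -- Clashing tasks overlap, whereas the peak of v separates tasks on opposite sides.
        ...   | inj₁ p | inj₂ q = contradiction (proj₁ (proj₂ cl)) (<⇒≯ (≤-<-trans p q))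
        ...   | inj₂ p | inj₁ q = contradiction (≤-trans (s≤e i) (<⇒≤ (proj₁ cl))) (<⇒≱ (<-trans (≤-<-trans (s≤e j) (e<t j)) (≤-<-trans q p)))

    two-colouring : ∀ r → ∃ (ProperFrom r) → ∃ (ProperFrom 0)
    two-colouring zero    p = p
    two-colouring (suc r) p = two-colouring r (two-colouring-step r p)

    clashFree-half : (f : Fin n → ℕ) →
      ∃[ S′ ] (∀ i → S′ i ≡ true → S i ≡ true) × ClashFree S′ × sumOn S f ≤ 2 * sumOn S′ f
    clashFree-half f with upper-bound key
    -- No key reaches r, so any colouring is proper from r on and the descent can start.
    ... | r , key<r with two-colouring r ((λ _ → false) , λ i j _ _ r≤i → contradiction (key<r i) (≤⇒≯ r≤i))
    ...   | c , ok with maximal-term (λ x → sumOn (colourClass S (c′ c) x) f)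
      where
      c′ : (Fin n → Bool) → Fin n → Fin 2
      c′ c i = if c i then zero else suc zero
    ...     | x , le = S′ , (λ i → proj₁ ∘ ∧-true) , clash-free , subst (_≤ 2 * sumOn S′ f) (sumOn-classes S c′ f) le
      where
      c′ : Fin n → Fin 2
      c′ i = if c i then zero else suc zero
      c′-injective : ∀ {a b} → (if a then zero {1} else suc zero) ≡ (if b then zero else suc zero) → a ≡ b
      c′-injective {true}  {true}  _ = refl
      c′-injective {false} {false} _ = refl
      c′-injective {true}  {false} ()
      c′-injective {false} {true}  ()
      S′ : Fin n → Bool
      S′ = colourClass S c′ x
      clash-free : ClashFree S′
      clash-free i j S′i S′j cl with ∧-true S′i | ∧-true S′j
      ... | Si , ci | Sj , cj = ok i j Si Sj z≤n z≤n cl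
        (c′-injective (trans (does-true (c′ i Fin.≟ x) ci) (sym (does-true (c′ j Fin.≟ x) cj))))

  -- If all four separations fail, a task covering the other's peak contradicts `Uncrossed`.
  -- Otherwise each peak lies outside the other interval. Comparing starts with peaks, the two mixed
  -- cases are clashes in one order or the other, and the two remaining ones would make the
  -- intervals end or start cyclically before each other.
  disjoint : ∀ {S} → Uncrossed S → ClashFree S → ∀ {i j} → S i ≡ true → S j ≡ true → i ≢ j → Disjoint i j
  disjoint un cf {i} {j} Si Sj i≢j with t i ≤? s j | t j ≤? s i | b i ≤? ℓ j | b j ≤? ℓ i
  ... | yes p | _ | _ | _ = inj₁ p
  ... | _ | yes p | _ | _ = inj₂ (inj₁ p)
  ... | _ | _ | yes p | _ = inj₂ (inj₂ (inj₁ p))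
  ... | _ | _ | _ | yes p = inj₂ (inj₂ (inj₂ p))
  ... | no ti≰sj | no tj≰si | no bi≰ℓj | no bj≰ℓi with covers? j (e i) | covers? i (e j)
  ...   | yes cr | _ = contradiction (un i j Si Sj i≢j cr) bj≰ℓi
  ...   | _ | yes cr = contradiction (un j i Sj Si (i≢j ∘ sym) cr) bi≰ℓj
  ...   | no ¬cr | no ¬cr′ with s j ≤? e i | s i ≤? e j
  ...     | no p | no q = contradiction (<-trans (≤-<-trans (s≤e i) (≰⇒> p)) (≤-<-trans (s≤e j) (≰⇒> q))) (<-irrefl refl)
  ...     | no p | yes q = contradiction
    (≰⇒> p , ≰⇒> ti≰sj , ≮⇒≥ (¬cr′ ∘ (q ,_)) , ≰⇒> bj≰ℓi , ≰⇒> bi≰ℓj) (cf i j Si Sj)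
  ...     | yes p | no q = contradiction
    (≰⇒> q , ≰⇒> tj≰si , ≮⇒≥ (¬cr ∘ (p ,_)) , ≰⇒> bi≰ℓj , ≰⇒> bj≰ℓi) (cf j i Sj Si)
  ...     | yes p | yes q = contradiction (≤-<-trans (≮⇒≥ (¬cr ∘ (p ,_))) (<-≤-trans (e<t i) (≮⇒≥ (¬cr′ ∘ (q ,_)))))
    (<⇒≯ (e<t j))

  disjoint-subset : (F : Fin n → Bool) → Packs F → ∀ k .{{_ : NonZero k}} → (∀ i → F i ≡ true → b i < k * d i) →
    (f : Fin n → ℕ) → ∃[ S ] (∀ i → S i ≡ true → F i ≡ true) ×
      (∀ {i j} → S i ≡ true → S j ≡ true → i ≢ j → Disjoint i j) × sumOn F f ≤ 2 * k * sumOn S f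
  disjoint-subset F packs k large f with uncrossed-class F packs k large f
  ... | S , S⊆F , un , le with clashFree-half S (λ i → ℓ<b F packs i ∘ S⊆F i) un f
  ...   | S′ , S′⊆S , cf , le′ = S′ , (λ i → S⊆F i ∘ S′⊆S i) ,
    disjoint (λ i j Si Sj → un i j (S′⊆S i Si) (S′⊆S j Sj)) cf , (begin
      sumOn F f            ≤⟨ le ⟩
      k * sumOn S f        ≤⟨ *-monoʳ-≤ k le′ ⟩
      k * (2 * sumOn S′ f) ≡⟨ *-assoc k 2 _ ⟨
      k * 2 * sumOn S′ f   ≡⟨ cong (_* sumOn S′ f) (*-comm k 2) ⟩
      2 * k * sumOn S′ f   ∎)
    where open ≤-Reasoning

-- The tables of the algorithm: entry toℕ q describes the task q, and further entries describe
-- walls that are not tasks.  The column just to the right of the peak of q is p (toℕ q).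
record Layout (n m : ℕ) (u : ℕ → ℕ) : Set where
  field
    tasks       : Tasks n m u
    s t d w p b ℓ : ℕ → ℕ
    s-task      : ∀ q → s (toℕ q) ≡ Tasks.s tasks q
    t-task      : ∀ q → t (toℕ q) ≡ Tasks.t tasks q
    d-task      : ∀ q → d (toℕ q) ≡ Tasks.d tasks q
    w-task      : ∀ q → w (toℕ q) ≡ Tasks.w tasks q
    p-task      : ∀ q → p (toℕ q) ≡ suc (Tasks.e tasks q)
    b-task      : ∀ q → b (toℕ q) ≡ Tasks.b tasks q
    ℓ-task      : ∀ q → ℓ (toℕ q) ≡ Tasks.ℓ tasks q

-- Plans: trees of disjoint rectangles and their feasibility

module Planning {n m : ℕ} {u : ℕ → ℕ} (Λ : Layout n m u) where
  open Layout Λ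
  private module T = Tasks tasks

  -- A task that does not start below its left wall i lies to the right of the peak of i, and above i
  -- wherever it overlaps i.
  RightOf : ℕ → ℕ → Set
  RightOf i q = p i ≤ s q × ℓ i ≤ ℓ q × (t i ≤ s q ⊎ b i ≤ ℓ q)

  -- Mirror image of `RightOf`. As `p j` is one more than the peak, the strict inequality lets q end
  -- at the peak of j at the latest, so that q does not use that edge.
  LeftOf : ℕ → ℕ → Set
  LeftOf j q = t q < p j × ℓ j ≤ ℓ q × (t q ≤ s j ⊎ b j ≤ ℓ q)

  -- The clause `d q ≤ b q` keeps the truncated subtraction in `ℓ q` honest: it guarantees
  -- `ℓ q + d q ≡ b q`.
  Fits : ℕ → ℕ → ℕ → Set
  Fits i j q = RightOf i q × LeftOf j q × d q ≤ b q

  -- A search tree ordered by peaks. Disjointness is not a field: each node is checked only against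
  -- its two nearest walls, which is all the program can afford to test, and the rest follows by
  -- transitivity. Walls are natural numbers because the outermost two are not tasks.
  data Plan : ℕ → ℕ → Set where
    empty : ∀ {i j} → Plan i j
    node  : ∀ {i j} (q : Fin n) → Fits i j (toℕ q) → Plan i (toℕ q) → Plan (toℕ q) j → Plan i j

  height : ∀ {i j} → Plan i j → ℕ
  height empty          = 0
  height (node _ _ P Q) = suc (height P ⊔ height Q)

  total : ∀ {i j} → (Fin n → ℕ) → Plan i j → ℕ
  total f empty          = 0
  total f (node q _ P Q) = f q + (total f P + total f Q)

  member : ∀ {i j} → Plan i j → Fin n → Bool
  member empty          x = false
  member (node q _ P Q) x = does (x Fin.≟ q) ∨ (member P x ∨ member Q x)

  s<p : ∀ q → s (toℕ q) < p (toℕ q)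
  s<p q = subst₂ _<_ (sym (s-task q)) (sym (p-task q)) (s≤s (T.s≤e q))

  p≤t : ∀ q → p (toℕ q) ≤ t (toℕ q)
  p≤t q = subst₂ _≤_ (sym (p-task q)) (sym (t-task q)) (T.e<t q)

  -- Only the wall j needs an argument. Either q ends before j starts, and x ends before
  -- `p q ≤ t q`; or q lies above j, and x starts at least as high as q.
  fits-left : ∀ {i j q x} → Fits i j (toℕ q) → Fits i (toℕ q) x → Fits i j x
  fits-left {i} {j} {q} {x} (_ , (tq<pj , ℓj≤ℓq , q∣j) , _) (x∣i , (tx<pq , ℓq≤ℓx , _) , d≤b) =
    x∣i , (<-≤-trans tx<pq (≤-trans (p≤t q) (<⇒≤ tq<pj)) , ≤-trans ℓj≤ℓq ℓq≤ℓx , x∣j q∣j) , d≤b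
    where
    x∣j : t (toℕ q) ≤ s j ⊎ b j ≤ ℓ (toℕ q) → t x ≤ s j ⊎ b j ≤ ℓ x
    x∣j (inj₁ le) = inj₁ (≤-trans (<⇒≤ tx<pq) (≤-trans (p≤t q) le))
    x∣j (inj₂ le) = inj₂ (≤-trans le ℓq≤ℓx)

  fits-right : ∀ {i j q x} → Fits i j (toℕ q) → Fits (toℕ q) j x → Fits i j x
  fits-right {i} {j} {q} {x} ((pi≤sq , ℓi≤ℓq , i∣q) , _) ((pq≤sx , ℓq≤ℓx , _) , x∣j , d≤b) =
    (≤-trans pi≤sq sq≤sx , ≤-trans ℓi≤ℓq ℓq≤ℓx , i∣x i∣q) , x∣j , d≤b
    where
    sq≤sx : s (toℕ q) ≤ s x
    sq≤sx = ≤-trans (<⇒≤ (s<p q)) pq≤sx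
    i∣x : t i ≤ s (toℕ q) ⊎ b i ≤ ℓ (toℕ q) → t i ≤ s x ⊎ b i ≤ ℓ x
    i∣x (inj₁ le) = inj₁ (≤-trans le sq≤sx)
    i∣x (inj₂ le) = inj₂ (≤-trans le ℓq≤ℓx)

  member-fits : ∀ {i j} (P : Plan i j) x → member P x ≡ true → Fits i j (toℕ x)
  member-fits (node q fits P Q) x x∈ with x Fin.≟ q | member P x in x∈P | member Q x in x∈Q
  ... | yes refl | _     | _    = fits
  ... | no _     | true  | _    = fits-left {q = q} {toℕ x} fits (member-fits P x x∈P)
  ... | no _     | false | true = fits-right {q = q} {toℕ x} fits (member-fits Q x x∈Q)

  -- No task is counted twice: members of P end before `p q`, those of Q start at `p q` or later,
  -- and q itself straddles that point.
  total≡sumOn : ∀ {i j} f (P : Plan i j) → total f P ≡ sumOn (member P) f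
  total≡sumOn f empty = sym (sum-zero {n} (λ _ → refl))
  total≡sumOn f (node q fits P Q) = begin-equality
    f q + (total f P + total f Q)
      ≡⟨ cong₂ _+_ (sum-point q f) (cong₂ _+_ (sym (total≡sumOn f P)) (sym (total≡sumOn f Q))) ⟨
    sum (λ x → if does (x Fin.≟ q) then f x else 0) + (sumOn (member P) f + sumOn (member Q) f)
      ≡⟨ cong (_ +_) (∑-distrib-+ (restrict (member P) f) (restrict (member Q) f)) ⟨
    sum (λ x → if does (x Fin.≟ q) then f x else 0) + sum (λ x → restrict (member P) f x + restrict (member Q) f x)
      ≡⟨ ∑-distrib-+ (λ x → if does (x Fin.≟ q) then f x else 0) _ ⟨
    sum (λ x → (if does (x Fin.≟ q) then f x else 0) + (restrict (member P) f x + restrict (member Q) f x))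
      ≡⟨ sum-cong-≗ split ⟩
    sumOn (member (node q fits P Q)) f ∎
    where
    open ≤-Reasoning
    split : ∀ x → (if does (x Fin.≟ q) then f x else 0) + (restrict (member P) f x + restrict (member Q) f x)
          ≡ restrict (member (node q fits P Q)) f x
    split x with x Fin.≟ q | member P x in x∈P | member Q x in x∈Q
    ... | no _ | false | false = refl
    ... | no _ | false | true  = refl
    ... | no _ | true  | false = +-identityʳ _
    ... | yes _ | false | false = +-identityʳ _
    ... | no _ | true  | true  = contradiction
      (<-≤-trans (proj₁ (proj₁ (proj₂ (member-fits P x x∈P)))) (proj₁ (proj₁ (member-fits Q x x∈Q))))
      (<⇒≯ (<-≤-trans (s<p x) (p≤t x)))
    ... | yes refl | true | _  = contradiction (proj₁ (proj₁ (proj₂ (member-fits P x x∈P)))) (≤⇒≯ (p≤t x))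
    ... | yes refl | _ | true  = contradiction (proj₁ (proj₁ (member-fits Q x x∈Q))) (<⇒≱ (s<p x))

  total-zero : ∀ {i j} {f : Fin n → ℕ} (P : Plan i j) → (∀ x → member P x ≡ true → f x ≡ 0) → total f P ≡ 0
  total-zero {f = f} P h = trans (total≡sumOn f P) (sum-zero zeros)
    where
    zeros : ∀ x → restrict (member P) f x ≡ 0
    zeros x with member P x in x∈P
    ... | true  = h x x∈P
    ... | false = refl

  demandAt : ℕ → Fin n → ℕ
  demandAt x q = if does (T.covers? q x) then T.d q else 0

  demandAt-zero : ∀ {x q} → ¬ T.Covers q x → demandAt x q ≡ 0
  demandAt-zero {x} {q} ¬c rewrite dec-false (T.covers? q x) ¬c = refl

  ≤-cast : ∀ {x y x′ y′} → x ≡ x′ → y ≡ y′ → x ≤ y → x′ ≤ y′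
  ≤-cast = subst₂ _≤_

  d≤b⇒ : ∀ q → d (toℕ q) ≤ b (toℕ q) → T.d q ≤ T.b q
  d≤b⇒ q = subst₂ _≤_ (d-task q) (b-task q)

  -- Placing q below the members of a plan that all lie above q wherever q covers the column x.
  place : ∀ {i j} (q : Fin n) (P : Plan i j) x h → T.d q ≤ T.b q → h ≤ u x →
    (T.Covers q x → h ≤ T.ℓ q) →
    (∀ g → member P g ≡ true → T.Covers g x → h ≤ T.ℓ g) →
    (∀ g → member P g ≡ true → T.Covers g x → T.Covers q x → T.b q ≤ T.ℓ g) →
    (∀ h → h ≤ u x → (∀ g → member P g ≡ true → T.Covers g x → h ≤ T.ℓ g) → h + total (demandAt x) P ≤ u x) →
    h + (demandAt x q + total (demandAt x) P) ≤ u x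
  place q P x h d≤b h≤u h≤ℓq h≤ above ih = go (T.covers? q x)
    where
    open ≤-Reasoning
    go : (c? : Dec (T.Covers q x)) → h + ((if does c? then T.d q else 0) + total (demandAt x) P) ≤ u x
    go (no  _) = ih h h≤u h≤
    go (yes c) = begin
      h + (T.d q + total (demandAt x) P)       ≡⟨ +-assoc h (T.d q) _ ⟨
      h + T.d q + total (demandAt x) P         ≤⟨ +-monoˡ-≤ _ (+-monoˡ-≤ (T.d q) (h≤ℓq c)) ⟩
      T.ℓ q + T.d q + total (demandAt x) P     ≡⟨ cong (_+ total (demandAt x) P) (m∸n+n≡m d≤b) ⟩
      T.b q + total (demandAt x) P             ≤⟨ ih (T.b q) (T.least q x (proj₁ c) (proj₂ c)) (λ g g∈ cg → above g g∈ cg c) ⟩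
      u x                                      ∎

  -- Induction with a rising floor h: in column x, once q is placed, the rest of the tree lies above
  -- `b q`, which becomes the new floor. Columns left of `p q` meet no member of Q, all others no
  -- member of P, so only one branch is followed.
  stack : ∀ {i j} (P : Plan i j) x h → h ≤ u x →
    (∀ g → member P g ≡ true → T.Covers g x → h ≤ T.ℓ g) → h + total (demandAt x) P ≤ u x
  stack empty x h h≤u _ = subst (_≤ u x) (sym (+-identityʳ h)) h≤u
  stack (node q fits P Q) x h h≤u above with x <? p (toℕ q)
  ... | yes x<pq = subst (_≤ u x) (cong (λ z → h + (demandAt x q + z)) P+Q≡P)
    (place q P x h (d≤b⇒ q (proj₂ (proj₂ fits))) h≤u (above q q∈) (λ g → above g ∘ P⊆ g) over (stack P x))
    where
    q∈ : member (node q fits P Q) q ≡ true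
    q∈ rewrite dec-true (q Fin.≟ q) refl = refl
    P⊆ : ∀ g → member P g ≡ true → member (node q fits P Q) g ≡ true
    P⊆ g g∈ rewrite g∈ = ∨-zeroʳ _
    P+Q≡P : total (demandAt x) P ≡ total (demandAt x) P + total (demandAt x) Q
    P+Q≡P = sym (trans (cong (total (demandAt x) P +_) (total-zero Q λ g g∈ → demandAt-zero λ c →
      <⇒≱ (<-≤-trans x<pq (subst (_ ≤_) (s-task g) (proj₁ (proj₁ (member-fits Q g g∈))))) (proj₁ c))) (+-identityʳ _))
    over : ∀ g → member P g ≡ true → T.Covers g x → T.Covers q x → T.b q ≤ T.ℓ g
    over g g∈ cg cq with member-fits P g g∈
    ... | _ , (_ , _ , inj₁ tg≤sq) , _ = contradiction (≤-trans (subst₂ _≤_ (t-task g) (s-task q) tg≤sq) (proj₁ cq)) (<⇒≱ (proj₂ cg))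
    ... | _ , (_ , _ , inj₂ bq≤ℓg) , _ = subst₂ _≤_ (b-task q) (ℓ-task g) bq≤ℓg
  ... | no x≮pq = subst (λ z → h + (demandAt x q + (z + total (demandAt x) Q)) ≤ u x) (sym P≡0)
    (place q Q x h (d≤b⇒ q (proj₂ (proj₂ fits))) h≤u (above q q∈) (λ g → above g ∘ Q⊆ g) over (stack Q x))
    where
    q∈ : member (node q fits P Q) q ≡ true
    q∈ rewrite dec-true (q Fin.≟ q) refl = refl
    Q⊆ : ∀ g → member Q g ≡ true → member (node q fits P Q) g ≡ true
    Q⊆ g g∈ rewrite g∈ = trans (cong (does (g Fin.≟ q) ∨_) (∨-zeroʳ (member P g))) (∨-zeroʳ _)
    P≡0 : total (demandAt x) P ≡ 0
    P≡0 = total-zero P λ g g∈ → demandAt-zero λ c →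
      <⇒≱ (proj₂ c) (≤-trans (<⇒≤ (subst (_< _) (t-task g) (proj₁ (proj₁ (proj₂ (member-fits P g g∈)))))) (≮⇒≥ x≮pq))
    over : ∀ g → member Q g ≡ true → T.Covers g x → T.Covers q x → T.b q ≤ T.ℓ g
    over g g∈ cg cq with member-fits Q g g∈
    ... | (_ , _ , inj₁ tq≤sg) , _ = contradiction (≤-trans (subst₂ _≤_ (t-task q) (s-task g) tq≤sg) (proj₁ cg)) (<⇒≱ (proj₂ cq))
    ... | (_ , _ , inj₂ bq≤ℓg) , _ = subst₂ _≤_ (b-task q) (ℓ-task g) bq≤ℓg

  plan-packs : ∀ {i j} (P : Plan i j) → T.Packs (member P)
  plan-packs P x _ = begin
    sumOn (T.through (member P) x) T.d  ≡⟨ sum-cong-≗ pointwise ⟩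
    sumOn (member P) (demandAt x)       ≡⟨ total≡sumOn (demandAt x) P ⟨
    total (demandAt x) P                ≤⟨ stack P x 0 z≤n (λ _ _ _ → z≤n) ⟩
    u x                                 ∎
    where
    open ≤-Reasoning
    pointwise : ∀ g → restrict (T.through (member P) x) T.d g ≡ restrict (member P) (demandAt x) g
    pointwise g with member P g
    ... | true  = refl
    ... | false = refl

  -- The lowest task of a disjoint set separates the others by its peak.
  plan-for : ∀ r {i j} (S : Fin n → Bool) → p j ≤ p i + r → (∀ g → S g ≡ true → Fits i j (toℕ g)) →
    (∀ {g g′} → S g ≡ true → S g′ ≡ true → g ≢ g′ → T.Disjoint g g′) → (f : Fin n → ℕ) →
    Σ (Plan i j) λ P → height P ≤ r × sumOn S f ≤ total f P
  plan-for r {i} {j} S gap fits disjoint f with argmin S T.ℓ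
  ... | inj₁ none = empty , z≤n , ≤-reflexive (sum-zero λ g → cong (λ z → if z then f g else 0) (none g))
  plan-for zero {i} {j} S gap fits disjoint f | inj₂ (q , Sq , lowest) with fits q Sq
  ... | (pi≤sq , _) , (tq<pj , _) , _ = contradiction (subst (p j ≤_) (+-identityʳ (p i)) gap)
    (<⇒≱ (≤-<-trans pi≤sq (<-trans (<-≤-trans (s<p q) (p≤t q)) tq<pj)))
  plan-for (suc r) {i} {j} S gap fits disjoint f | inj₂ (q , Sq , lowest) =
    node q (fits q Sq) (proj₁ left) (proj₁ right) , s≤s (⊔-lub (proj₁ (proj₂ left)) (proj₁ (proj₂ right))) , (begin
      sumOn S f
        ≤⟨ sum-mono split ⟩
      sum (λ x → (if does (x Fin.≟ q) then f x else 0) + (restrict Sₗ f x + restrict Sᵣ f x))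
        ≡⟨ ∑-distrib-+ (λ x → if does (x Fin.≟ q) then f x else 0) _ ⟩
      sum (λ x → if does (x Fin.≟ q) then f x else 0) + sum (λ x → restrict Sₗ f x + restrict Sᵣ f x)
        ≡⟨ cong₂ _+_ (sum-point q f) (∑-distrib-+ (restrict Sₗ f) (restrict Sᵣ f)) ⟩
      f q + (sumOn Sₗ f + sumOn Sᵣ f)
        ≤⟨ +-monoʳ-≤ (f q) (+-mono-≤ (proj₂ (proj₂ left)) (proj₂ (proj₂ right))) ⟩
      f q + (total f (proj₁ left) + total f (proj₁ right)) ∎)
    where
    open ≤-Reasoning
    q′ : ℕ
    q′ = toℕ q
    Sₗ Sᵣ : Fin n → Bool
    Sₗ g = S g ∧ does (T.t g <? p q′)
    Sᵣ g = S g ∧ does (p q′ ≤? T.s g)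
    ℓ<b : ∀ g → S g ≡ true → T.ℓ g < T.b g
    ℓ<b g Sg = ∸-monoʳ-< (T.d>0 g) (d≤b⇒ g (proj₂ (proj₂ (fits g Sg))))
    sides : ∀ g → S g ≡ true → g ≢ q →
      (T.t g < p q′ × (T.t g ≤ T.s q ⊎ T.b q ≤ T.ℓ g)) ⊎ (p q′ ≤ T.s g × (T.t q ≤ T.s g ⊎ T.b q ≤ T.ℓ g))
    sides g Sg g≢q with disjoint Sg Sq g≢q
    ... | inj₁ le = inj₁ (≤-<-trans le (subst (_< p q′) (s-task q) (s<p q)) , inj₁ le)
    ... | inj₂ (inj₁ le) = inj₂ (≤-trans (subst (p q′ ≤_) (t-task q) (p≤t q)) le , inj₁ le)
    ... | inj₂ (inj₂ (inj₁ le)) = contradiction (≤-trans le (lowest g Sg)) (<⇒≱ (ℓ<b g Sg))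
    ... | inj₂ (inj₂ (inj₂ le)) with T.t g <? p q′ | p q′ ≤? T.s g
    ...   | yes lt | _ = inj₁ (lt , inj₂ le)
    ...   | _ | yes le′ = inj₂ (le′ , inj₂ le)
    -- Here g would use the peak edge of q and so have `b g ≤ b q`, although it lies above q, with
    -- `b q ≤ ℓ g < b g`.
    ...   | no ¬lt | no ¬le = contradiction (T.least g (T.e q)
      (s≤s⁻¹ (subst (T.s g <_) (p-task q) (≰⇒> ¬le))) (subst (_≤ T.t g) (p-task q) (≮⇒≥ ¬lt)))
      (<⇒≱ (≤-<-trans le (ℓ<b g Sg)))
    split : ∀ x → restrict S f x ≤ (if does (x Fin.≟ q) then f x else 0) + (restrict Sₗ f x + restrict Sᵣ f x)
    split x with S x in Sx
    ... | false = z≤n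
    ... | true with x Fin.≟ q
    ...   | yes _ = m≤m+n _ _
    ...   | no x≢q with sides x Sx x≢q
    ...     | inj₁ (lt , _) rewrite dec-true (T.t x <? p q′) lt = m≤m+n _ _
    ...     | inj₂ (le , _) rewrite dec-true (p q′ ≤? T.s x) le = m≤n+m _ _
    left : Σ (Plan i q′) λ P → height P ≤ r × sumOn Sₗ f ≤ total f P
    left = plan-for r Sₗ gapₗ fitsₗ (λ Sg Sg′ → disjoint (proj₁ (∧-true Sg)) (proj₁ (∧-true Sg′))) f
      where
      -- As `p i ≤ s q < p q ≤ t q < p j`, both halves lose at least one column, which pays for one
      -- level of height.
      gapₗ : p q′ ≤ p i + r
      gapₗ = s≤s⁻¹ (≤-trans (≤-<-trans (p≤t q) (proj₁ (proj₁ (proj₂ (fits q Sq))))) (subst (p j ≤_) (+-suc (p i) r) gap))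
      fitsₗ : ∀ g → Sₗ g ≡ true → Fits i q′ (toℕ g)
      fitsₗ g Sₗg with ∧-true Sₗg
      ... | Sg , lt? with does-true (T.t g <? p q′) lt? | g Fin.≟ q
      ...   | lt | yes refl = contradiction (subst (p q′ ≤_) (t-task q) (p≤t q)) (<⇒≱ lt)
      ...   | lt | no g≢q with sides g Sg g≢q | fits g Sg
      ...     | inj₂ (le , _) | _ = contradiction (<-≤-trans lt le) (<⇒≯ (≤-<-trans (T.s≤e g) (T.e<t g)))
      ...     | inj₁ (_ , o) | g∣i , _ , d≤b = g∣i ,
        (subst (_< p q′) (sym (t-task g)) lt , ≤-cast (sym (ℓ-task q)) (sym (ℓ-task g)) (lowest g Sg) , over o) , d≤b
        where
        over : T.t g ≤ T.s q ⊎ T.b q ≤ T.ℓ g → t (toℕ g) ≤ s q′ ⊎ b q′ ≤ ℓ (toℕ g)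
        over (inj₁ le) = inj₁ (≤-cast (sym (t-task g)) (sym (s-task q)) le)
        over (inj₂ le) = inj₂ (≤-cast (sym (b-task q)) (sym (ℓ-task g)) le)
    right : Σ (Plan q′ j) λ P → height P ≤ r × sumOn Sᵣ f ≤ total f P
    right = plan-for r Sᵣ gapᵣ fitsᵣ (λ Sg Sg′ → disjoint (proj₁ (∧-true Sg)) (proj₁ (∧-true Sg′))) f
      where
      gapᵣ : p j ≤ p q′ + r
      gapᵣ = ≤-trans (subst (p j ≤_) (+-suc (p i) r) gap) (+-monoˡ-≤ r (≤-<-trans (proj₁ (proj₁ (fits q Sq))) (s<p q)))
      fitsᵣ : ∀ g → Sᵣ g ≡ true → Fits q′ j (toℕ g)
      fitsᵣ g Sᵣg with ∧-true Sᵣg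
      ... | Sg , le? with does-true (p q′ ≤? T.s g) le? | g Fin.≟ q
      ...   | le | yes refl = contradiction (subst (_< p q′) (s-task q) (s<p q)) (≤⇒≯ le)
      ...   | le | no g≢q with sides g Sg g≢q | fits g Sg
      ...     | inj₁ (lt , _) | _ = contradiction (<-≤-trans lt le) (<⇒≯ (≤-<-trans (T.s≤e g) (T.e<t g)))
      ...     | inj₂ (_ , o) | _ , g∣j , d≤b =
        (subst (p q′ ≤_) (sym (s-task g)) le , ≤-cast (sym (ℓ-task q)) (sym (ℓ-task g)) (lowest g Sg) , over o) , g∣j , d≤b
        where
        over : T.t q ≤ T.s g ⊎ T.b q ≤ T.ℓ g → t q′ ≤ s (toℕ g) ⊎ b q′ ≤ ℓ (toℕ g)
        over (inj₁ le) = inj₁ (≤-cast (sym (t-task q)) (sym (s-task g)) le)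
        over (inj₂ le) = inj₂ (≤-cast (sym (b-task q)) (sym (ℓ-task g)) le)

-- A total-correctness logic with running times

update-same : ∀ {A : Set} (f : ℕ → A) x a → update f x a x ≡ a
update-same f x a rewrite dec-true (x ≟ x) refl = refl

update-other : ∀ {A : Set} (f : ℕ → A) {x y} a → y ≢ x → update f x a y ≡ f y
update-other f {x} {y} a y≢x rewrite dec-false (y ≟ x) y≢x = refl

setRegister : ℕ → ℕ → State → State
setRegister x v σ = state (update (registers σ) x v) (arrays σ)

setEntry : ℕ → ℕ → ℕ → State → State
setEntry a k v σ = state (registers σ) (update (arrays σ) a (update (arrays σ a) k v))

writes : Program → ℕ → Bool
writes skip                    x = false
writes (y ≔ _)                 x = does (x ≟ y)
writes (_ [ _ ]≔ _)            x = false
writes (P ⨾ Q)                 x = writes P x ∨ writes Q x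
writes (ifNonzero _ ⟨ P ∣ Q ⟩) x = writes P x ∨ writes Q x
writes (whileNonzero _ ⟨ P ⟩)  x = writes P x

∨-false : ∀ {a b} → a ∨ b ≡ false → a ≡ false × b ≡ false
∨-false {false} {false} _ = refl , refl

-- Lets `for-runs` check syntactically that a loop body leaves counter and bound alone; for concrete
-- programs `refl` settles this.
frame : ∀ {P σ σ′ t x} → ⟨ P , σ ⟩⇓⟨ σ′ , t ⟩ → writes P x ≡ false → registers σ′ x ≡ registers σ x
frame ⇓skip _ = refl
frame {y ≔ e} {σ} {x = x} ⇓assign h rewrite h = refl
frame ⇓store _ = refl
frame {P ⨾ Q} {x = x} (⇓seq r r′) h with ∨-false {writes P x} h
... | p , q = trans (frame r′ q) (frame r p)
frame {ifNonzero _ ⟨ P ∣ Q ⟩} {x = x} (⇓if-nonzero _ r) h = frame r (proj₁ (∨-false {writes P x} h))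
frame {ifNonzero _ ⟨ P ∣ Q ⟩} {x = x} (⇓if-zero _ r) h = frame r (proj₂ (∨-false {writes P x} h))
frame (⇓while-zero _) _ = refl
frame (⇓while-nonzero _ r r′) h = trans (frame r′ h) (frame r h)

for_below_⟨_⟩ : ℕ → ℕ → Program → Program
for x below y ⟨ P ⟩ = x ≔ lit 0 ⨾ whileNonzero (reg y ⊖ reg x) ⟨ P ⨾ x ≔ reg x ⊕ lit 1 ⟩

-- Calibrated for counted loops, whose trip count is accounted for by a power of M. For a body of
-- factor c it yields 2 + 8 + (c + 4) = 14 + c: 2 for the initialisation, 4 for the last test, and 8
-- for test and increment in each iteration.
factor : Program → ℕ
factor skip                    = 1
factor (_ ≔ e)                 = 1 + cost e
factor (_ [ e ]≔ f)            = 1 + cost e + cost f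
factor (P ⨾ Q)                 = factor P + factor Q
factor (ifNonzero e ⟨ P ∣ Q ⟩) = 1 + cost e + (factor P + factor Q)
factor (whileNonzero _ ⟨ P ⟩)  = 8 + factor P

-- Started in σ, P halts after at most factor P * M ^ δ steps in a state satisfying Q.
module Logic (M : ℕ) (1≤M : 1 ≤ M) where

  record Runs (P : Program) (σ : State) (δ : ℕ) (Q : State → Set) : Set where
    constructor runs
    field
      {final} : State
      {time}  : ℕ
      run     : ⟨ P , σ ⟩⇓⟨ final , time ⟩
      bounded : time ≤ factor P * M ^ δ
      post    : Q final

  open Runs public

  1≤M^ : ∀ δ → 1 ≤ M ^ δ
  1≤M^ zero    = ≤-refl
  1≤M^ (suc δ) = *-mono-≤ 1≤M (1≤M^ δ)

  constant : ∀ c {δ} → c ≤ c * M ^ δ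
  constant c {δ} = subst (_≤ c * M ^ δ) (*-identityʳ c) (*-monoʳ-≤ c (1≤M^ δ))

  raise : ∀ {P σ δ δ′ Q} → δ ≤ δ′ → Runs P σ δ Q → Runs P σ δ′ Q
  raise {P} {δ = δ} {δ′} le (runs r b q) = runs r (≤-trans b (*-monoʳ-≤ (factor P) (mono δ δ′ le))) q
    where
    mono : ∀ δ δ′ → δ ≤ δ′ → M ^ δ ≤ M ^ δ′
    mono zero    δ′       _        = 1≤M^ δ′
    mono (suc δ) (suc δ′) (s≤s le) = *-monoʳ-≤ M (mono δ δ′ le)

  consequence : ∀ {P σ δ Q Q′} → (∀ {σ′} → Q σ′ → Q′ σ′) → Runs P σ δ Q → Runs P σ δ Q′
  consequence f (runs r b q) = runs r b (f q)

  skip-runs : ∀ {σ δ Q} → Q σ → Runs skip σ δ Q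
  skip-runs {δ = δ} q = runs ⇓skip (constant 1 {δ}) q

  assign-runs : ∀ {x e σ δ Q} → Q (setRegister x (eval e σ) σ) → Runs (x ≔ e) σ δ Q
  assign-runs {e = e} {δ = δ} q = runs ⇓assign (constant (1 + cost e) {δ}) q

  store-runs : ∀ {a e f σ δ Q} → Q (setEntry a (eval e σ) (eval f σ) σ) → Runs (a [ e ]≔ f) σ δ Q
  store-runs {e = e} {f} {δ = δ} q = runs ⇓store (constant (1 + cost e + cost f) {δ}) q

  infixr 4 _then_
  _then_ : ∀ {P P′ σ δ Q R} → Runs P σ δ Q → (∀ {σ′} → Q σ′ → Runs P′ σ′ δ R) → Runs (P ⨾ P′) σ δ R
  _then_ {P} {P′} {δ = δ} (runs r b q) k with k q
  ... | runs r′ b′ q′ = runs (⇓seq r r′) (≤-trans (+-mono-≤ b b′) (≤-reflexive (sym (*-distribʳ-+ (M ^ δ) (factor P) (factor P′))))) q′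

  if-runs : ∀ {e P P′ σ δ Q} → (eval e σ ≢ 0 → Runs P σ δ Q) → (eval e σ ≡ 0 → Runs P′ σ δ Q) →
    Runs (ifNonzero e ⟨ P ∣ P′ ⟩) σ δ Q
  if-runs {e} {P} {P′} {σ} {δ} h h′ = go (eval e σ ≟ 0)
    where
    total : ∀ {t c} → c ≤ factor P + factor P′ → t ≤ c * M ^ δ → 1 + cost e + t ≤ (1 + cost e + (factor P + factor P′)) * M ^ δ
    total le le′ = ≤-trans (+-mono-≤ (constant (1 + cost e) {δ}) (≤-trans le′ (*-monoˡ-≤ (M ^ δ) le)))
      (≤-reflexive (sym (*-distribʳ-+ (M ^ δ) (1 + cost e) (factor P + factor P′))))
    go : Dec (eval e σ ≡ 0) → Runs _ _ _ _
    go (yes z) with h′ z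
    ... | runs r b q = runs (⇓if-zero z r) (total (m≤n+m (factor P′) (factor P)) b) q
    go (no nz) with h nz
    ... | runs r b q = runs (⇓if-nonzero nz r) (total (m≤m+n (factor P) (factor P′)) b) q

  module _ {x y : ℕ} {P : Program} {N δ : ℕ} (Inv : ℕ → State → Set)
    (x≢y : x ≢ y) (px : writes P x ≡ false) (py : writes P y ≡ false)
    -- Initialising and incrementing the counter happen outside `P`, so the invariant must not speak
    -- of register x.
    (stable : ∀ i σ v → Inv i σ → Inv i (setRegister x v σ))
    (step : ∀ i σ → i < N → registers σ x ≡ i → Inv i σ → Runs P σ δ (Inv (suc i))) where

    private
      c : ℕ
      c = factor P

    Loop : Program
    Loop = whileNonzero (reg y ⊖ reg x) ⟨ P ⨾ x ≔ reg x ⊕ lit 1 ⟩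

    loop-runs : ∀ k i σ → i + k ≡ N → registers σ x ≡ i → registers σ y ≡ N → Inv i σ →
      Σ State λ σ′ → Σ ℕ λ t → ⟨ Loop , σ ⟩⇓⟨ σ′ , t ⟩ × t ≤ k * (8 + c * M ^ δ) + 4 × Inv N σ′
    loop-runs zero i σ refl rx ry inv rewrite +-identityʳ i =
      σ , 4 , ⇓while-zero (m≤n⇒m∸n≡0 (≤-reflexive (trans ry (sym rx)))) , ≤-refl , inv
    loop-runs (suc k) i σ refl rx ry inv with step i σ (m<m+n i (s≤s z≤n)) rx inv
    ... | runs {σ₁} {t₁} r₁ b₁ inv₁ with loop-runs k (suc i) (setRegister x (registers σ₁ x + 1) σ₁) (sym (+-suc i k))
            (trans (update-same (registers σ₁) x _) (trans (cong (_+ 1) (trans (frame r₁ px) rx)) (+-comm i 1)))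
            (trans (update-other (registers σ₁) _ (x≢y ∘ sym)) (trans (frame r₁ py) ry))
            (stable (suc i) σ₁ _ inv₁)
    ...   | σ₂ , t₂ , r₂ , b₂ , inv₂ = σ₂ , 4 + (t₁ + 4) + t₂ ,
      ⇓while-nonzero (m>n⇒m∸n≢0 (subst₂ _<_ (sym rx) (sym ry) (m<m+n i (s≤s z≤n)))) (⇓seq r₁ ⇓assign) r₂ ,
      (begin
        4 + (t₁ + 4) + t₂                                   ≡⟨ cong (_+ t₂) (cong (4 +_) (+-comm t₁ 4)) ⟩
        8 + t₁ + t₂                                         ≤⟨ +-mono-≤ (+-monoʳ-≤ 8 b₁) b₂ ⟩
        8 + c * M ^ δ + (k * (8 + c * M ^ δ) + 4)           ≡⟨ +-assoc (8 + c * M ^ δ) _ 4 ⟨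
        suc k * (8 + c * M ^ δ) + 4                         ∎) , inv₂
      where open ≤-Reasoning

    for-runs : ∀ {σ} → registers σ y ≡ N → N ≤ M → Inv 0 σ → Runs (for x below y ⟨ P ⟩) σ (suc δ) (Inv N)
    for-runs {σ} ry N≤M inv with loop-runs N 0 (setRegister x 0 σ) refl (update-same (registers σ) x 0)
      (trans (update-other (registers σ) _ (x≢y ∘ sym)) ry) (stable 0 σ 0 inv)
    ... | σ′ , t , r , b , inv′ = runs (⇓seq ⇓assign r) (begin
      2 + t                                       ≤⟨ +-monoʳ-≤ 2 b ⟩
      2 + (N * (8 + c * M ^ δ) + 4)               ≡⟨ cong (2 +_) (+-comm _ 4) ⟩
      6 + N * (8 + c * M ^ δ)                     ≤⟨ +-mono-≤ (constant 6 {suc δ}) (*-mono-≤ N≤M (+-monoˡ-≤ (c * M ^ δ) (constant 8 {δ}))) ⟩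
      6 * M ^ suc δ + M * (8 * M ^ δ + c * M ^ δ) ≡⟨ cong (λ z → 6 * M ^ suc δ + M * z) (*-distribʳ-+ (M ^ δ) 8 c) ⟨
      6 * M ^ suc δ + M * ((8 + c) * M ^ δ)       ≡⟨ cong (6 * M ^ suc δ +_) (*-assoc M (8 + c) (M ^ δ)) ⟨
      6 * M ^ suc δ + M * (8 + c) * M ^ δ         ≡⟨ cong (λ z → 6 * M ^ suc δ + z * M ^ δ) (*-comm M (8 + c)) ⟩
      6 * M ^ suc δ + (8 + c) * M * M ^ δ         ≡⟨ cong (6 * M ^ suc δ +_) (*-assoc (8 + c) M (M ^ δ)) ⟩
      6 * M ^ suc δ + (8 + c) * M ^ suc δ         ≡⟨ *-distribʳ-+ (M ^ suc δ) 6 (8 + c) ⟨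
      (14 + c) * M ^ suc δ                        ≡⟨ cong (λ z → (10 + z) * M ^ suc δ) (+-comm 4 c) ⟩
        (10 + (c + 4)) * M ^ suc δ                  ∎) inv′
      where open ≤-Reasoning

-- The dynamic program

-- Registers: 0 = n, 1 = m, 2 = N = n + 2, 3 = N * N, 4 = m + 1, 5 = round, 6 = i, 7 = j, 8 = q,
-- 9 = x, 10 = best value for (i , j), 11 = 1 + a task attaining it (0 if none), 12 = scratch.
-- Arrays beyond input and output: 6 = 1 + peak, 7 = b, 8 = ℓ, 9 = values, 10 = sets (as indicators).
-- Rows have length N = n + 2 in array 11 and planes have size N * N in array 12, so that
-- pair i j and cell i j x address tables indexed by two and three numbers below N.
pair : Expr → Expr → Expr
pair e f = load 11 e ⊕ f

cell : Expr → Expr → Expr → Expr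
cell e f g = load 12 e ⊕ load 11 f ⊕ g

-- A minimum vanishes iff one argument does, so it expresses the disjunctions of `RightOf` and
-- `LeftOf`, as sums express conjunctions.
minimum : Expr → Expr → Expr
minimum e f = e ⊖ (e ⊖ f)

-- Zero exactly if the task in register 8 fits between the walls in registers 6 and 7.
violation : Expr
violation =
  (load 6 (reg 6) ⊖ load 1 (reg 8)) ⊕
  (load 8 (reg 6) ⊖ load 8 (reg 8)) ⊕
  minimum (load 2 (reg 6) ⊖ load 1 (reg 8)) (load 7 (reg 6) ⊖ load 8 (reg 8)) ⊕
  (load 2 (reg 8) ⊕ lit 1 ⊖ load 6 (reg 7)) ⊕
  (load 8 (reg 7) ⊖ load 8 (reg 8)) ⊕
  minimum (load 2 (reg 8) ⊖ load 1 (reg 7)) (load 7 (reg 7) ⊖ load 8 (reg 8)) ⊕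
  (load 3 (reg 8) ⊖ load 7 (reg 8))

candidate : Expr
candidate = load 4 (reg 8) ⊕ (load 9 (pair (reg 6) (reg 8)) ⊕ load 9 (pair (reg 8) (reg 7)))

improve : Program
improve = ifNonzero violation ⟨ skip ∣
  ifNonzero candidate ⊖ reg 10 ⟨ 10 ≔ candidate ⨾ 11 ≔ reg 8 ⊕ lit 1 ∣ skip ⟩ ⟩

-- Addition acts as union of indicators, because only `nonzero` is ever read off.
merge : Program
merge = 10 [ cell (reg 6) (reg 7) (reg 9) ]≔
  load 10 (cell (reg 6) (reg 12) (reg 9)) ⊕ load 10 (cell (reg 12) (reg 7) (reg 9))

record-choice : Program
record-choice =
  12 ≔ reg 11 ⊖ lit 1 ⨾
  9 [ pair (reg 6) (reg 7) ]≔ reg 10 ⨾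
  for 9 below 0 ⟨ merge ⟩ ⨾
  -- The loop overwrites the entry of q as well, so q can be marked only afterwards.
  10 [ cell (reg 6) (reg 7) (reg 12) ]≔ lit 1

search : Program
search =
  10 ≔ load 9 (pair (reg 6) (reg 7)) ⨾
  11 ≔ lit 0 ⨾
  for 8 below 0 ⟨ improve ⟩

relax : Program
relax = search ⨾ ifNonzero reg 11 ⟨ record-choice ∣ skip ⟩

rounds : Program
rounds = for 5 below 4 ⟨ for 6 below 2 ⟨ for 7 below 2 ⟨ relax ⟩ ⟩ ⟩

nonzero : ℕ → Bool
nonzero k = not (does (k ≟ 0))

nonzero-+ : ∀ a b → nonzero (a + b) ≡ nonzero a ∨ nonzero b
nonzero-+ zero    b = refl
nonzero-+ (suc a) b = refl

minimum-zero : ∀ {a b c d} → (a ∸ b) ∸ ((a ∸ b) ∸ (c ∸ d)) ≡ 0 → a ≤ b ⊎ c ≤ d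
minimum-zero {a} {b} {c} {d} eq with ≤-total (c ∸ d) (a ∸ b)
... | inj₁ le = inj₂ (m∸n≡0⇒m≤n (trans (sym (m∸[m∸n]≡n le)) eq))
... | inj₂ le = inj₁ (m∸n≡0⇒m≤n (trans (cong (a ∸ b ∸_) (sym (m≤n⇒m∸n≡0 le))) eq))

zero-minimum : ∀ {a b c d} → a ≤ b ⊎ c ≤ d → (a ∸ b) ∸ ((a ∸ b) ∸ (c ∸ d)) ≡ 0
zero-minimum {a} {b} {c} {d} (inj₁ le) rewrite m≤n⇒m∸n≡0 le = 0∸n≡0 (0 ∸ (c ∸ d))
zero-minimum {a} {b} {c} {d} (inj₂ le) rewrite m≤n⇒m∸n≡0 le = n∸n≡0 (a ∸ b)

-- Soundness and completeness of the dynamic program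

module DynamicProgram {n m : ℕ} {u : ℕ → ℕ} (Λ : Layout n m u)
  (M : ℕ) (1≤M : 1 ≤ M) (n≤M : n ≤ M) (N≤M : n + 2 ≤ M) where
  open Layout Λ
  open Planning Λ
  open Logic M 1≤M

  N : ℕ
  N = n + 2

  n≤N : n ≤ N
  n≤N = m≤m+n n 2

  task<N : ∀ (x : Fin n) → toℕ x < N
  task<N x = <-≤-trans (toℕ<n x) n≤N

  pairAt : ℕ → ℕ → ℕ
  pairAt i j = i * N + j

  cellAt : ℕ → ℕ → ℕ → ℕ
  cellAt i j x = i * (N * N) + j * N + x

  pairAt-injective : ∀ i i′ {j j′} → j < N → j′ < N → pairAt i j ≡ pairAt i′ j′ → i ≡ i′ × j ≡ j′
  pairAt-injective i i′ = lex-≡ {N} {i} {i′}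

  cellAt-injective : ∀ i i′ {j x j′ x′} → j < N → j′ < N → x < N → x′ < N →
    cellAt i j x ≡ cellAt i′ j′ x′ → (i ≡ i′ × j ≡ j′) × x ≡ x′
  cellAt-injective i i′ {j} {x} {j′} {x′} j<N j′<N x<N x′<N eq
    with lex-≡ {N} {i * N + j} {i′ * N + j′} x<N x′<N (trans (sym (flat i j x)) (trans eq (flat i′ j′ x′)))
    where
    flat : ∀ i j x → cellAt i j x ≡ (i * N + j) * N + x
    flat i j x = cong (_+ x) (trans (cong (_+ j * N) (sym (*-assoc i N N))) (sym (*-distribʳ-+ N (i * N) j)))
  ... | eq₁ , eq₂ = pairAt-injective i i′ j<N j′<N eq₁ , eq₂

  -- Indexed by registers and arrays instead of a state, so that writes to other places leave the
  -- indices definitionally unchanged.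
  record Context (r₀ r₂ : ℕ) (a₁ a₂ a₃ a₄ a₆ a₇ a₈ a₁₁ a₁₂ : ℕ → ℕ) : Set where
    field
      r₀≡  : r₀ ≡ n
      r₂≡  : r₂ ≡ N
      a₁≡  : a₁ ≡ s
      a₂≡  : a₂ ≡ t
      a₃≡  : a₃ ≡ d
      a₄≡  : a₄ ≡ w
      a₆≡  : a₆ ≡ p
      a₇≡  : a₇ ≡ b
      a₈≡  : a₈ ≡ ℓ
      a₁₁≡ : ∀ i → i < N → a₁₁ i ≡ i * N
      a₁₂≡ : ∀ i → i < N → a₁₂ i ≡ i * (N * N)

  open Context

  ContextOf : State → Set
  ContextOf σ = Context (registers σ 0) (registers σ 2) (arrays σ 1) (arrays σ 2) (arrays σ 3) (arrays σ 4)
    (arrays σ 6) (arrays σ 7) (arrays σ 8) (arrays σ 11) (arrays σ 12)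

  violation⇔ : ∀ {σ i j q} → ContextOf σ → registers σ 6 ≡ i → registers σ 7 ≡ j → registers σ 8 ≡ q →
    (eval violation σ ≡ 0 → Fits i j q) × (Fits i j q → eval violation σ ≡ 0)
  violation⇔ {σ} {i} {j} {q} C i≡ j≡ q≡
    rewrite i≡ | j≡ | q≡ | a₁≡ C | a₂≡ C | a₃≡ C | a₆≡ C | a₇≡ C | a₈≡ C = to , from
    where
    v₁ = p i ∸ s q
    v₂ = ℓ i ∸ ℓ q
    v₃ = (t i ∸ s q) ∸ ((t i ∸ s q) ∸ (b i ∸ ℓ q))
    v₄ = t q + 1 ∸ p j
    v₅ = ℓ j ∸ ℓ q
    v₆ = (t q ∸ s j) ∸ ((t q ∸ s j) ∸ (b j ∸ ℓ q))
    v₇ = d q ∸ b q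
    to : v₁ + v₂ + v₃ + v₄ + v₅ + v₆ + v₇ ≡ 0 → Fits i j q
    to z₇ = (zero₁ , zero₂ , minimum-zero {t i} zero₃) ,
            (subst (_≤ p j) (+-comm (t q) 1) zero₄ , zero₅ , minimum-zero {t q} zero₆) , zero₇
      where
      z₆ = m+n≡0⇒m≡0 (v₁ + v₂ + v₃ + v₄ + v₅ + v₆) z₇
      z₅ = m+n≡0⇒m≡0 (v₁ + v₂ + v₃ + v₄ + v₅) z₆
      z₄ = m+n≡0⇒m≡0 (v₁ + v₂ + v₃ + v₄) z₅
      z₃ = m+n≡0⇒m≡0 (v₁ + v₂ + v₃) z₄
      z₂ = m+n≡0⇒m≡0 (v₁ + v₂) z₃
      zero₁ = m∸n≡0⇒m≤n (m+n≡0⇒m≡0 v₁ z₂)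
      zero₂ = m∸n≡0⇒m≤n (m+n≡0⇒n≡0 v₁ z₂)
      zero₃ = m+n≡0⇒n≡0 (v₁ + v₂) z₃
      zero₄ = m∸n≡0⇒m≤n (m+n≡0⇒n≡0 (v₁ + v₂ + v₃) z₄)
      zero₅ = m∸n≡0⇒m≤n (m+n≡0⇒n≡0 (v₁ + v₂ + v₃ + v₄) z₅)
      zero₆ = m+n≡0⇒n≡0 (v₁ + v₂ + v₃ + v₄ + v₅) z₆
      zero₇ = m∸n≡0⇒m≤n (m+n≡0⇒n≡0 (v₁ + v₂ + v₃ + v₄ + v₅ + v₆) z₇)
    from : Fits i j q → v₁ + v₂ + v₃ + v₄ + v₅ + v₆ + v₇ ≡ 0
    from ((f₁ , f₂ , f₃) , (f₄ , f₅ , f₆) , f₇)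
      rewrite m≤n⇒m∸n≡0 f₁ | m≤n⇒m∸n≡0 f₂ | zero-minimum {t i} f₃ | m≤n⇒m∸n≡0 (subst (_≤ p j) (+-comm 1 (t q)) f₄)
        | m≤n⇒m∸n≡0 f₅ | zero-minimum {t q} f₆ | m≤n⇒m∸n≡0 f₇ = refl

  Table : Set
  Table = ℕ → ℕ

  offer : Table → ℕ → ℕ → ℕ → ℕ
  offer A i j q = w q + (A (pairAt i q) + A (pairAt q j))

  record Best (A : Table) (i j bound best arg : ℕ) : Set where
    field
      ≥old  : A (pairAt i j) ≤ best
      ≥all  : ∀ (x : Fin n) → toℕ x < bound → Fits i j (toℕ x) → offer A i j (toℕ x) ≤ best
      found : (arg ≡ 0 × best ≡ A (pairAt i j)) ⊎
              (Σ (Fin n) λ x → arg ≡ suc (toℕ x) × Fits i j (toℕ x) × best ≡ offer A i j (toℕ x))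

  open Best

  record Searching (i j : ℕ) (A B : Table) (bound : ℕ) (σ : State) : Set where
    field
      reg-i   : registers σ 6 ≡ i
      reg-j   : registers σ 7 ≡ j
      context : ContextOf σ
      table-A : arrays σ 9 ≡ A
      table-B : arrays σ 10 ≡ B
      best    : Best A i j bound (registers σ 10) (registers σ 11)

  open Searching

  pair-eval : ∀ {σ i j e f} → ContextOf σ → eval e σ ≡ i → eval f σ ≡ j → i < N → eval (pair e f) σ ≡ pairAt i j
  pair-eval {σ} {f = f} C refl refl i<N = cong (_+ eval f σ) (a₁₁≡ C _ i<N)

  cell-eval : ∀ {σ i j x e f g} → ContextOf σ → eval e σ ≡ i → eval f σ ≡ j → eval g σ ≡ x → i < N → j < N →
    eval (cell e f g) σ ≡ cellAt i j x
  cell-eval {σ} {g = g} C refl refl refl i<N j<N = cong₂ (λ y z → y + z + eval g σ) (a₁₂≡ C _ i<N) (a₁₁≡ C _ j<N)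

  candidate-eval : ∀ {σ i j q A} → ContextOf σ → registers σ 6 ≡ i → registers σ 7 ≡ j → registers σ 8 ≡ q → arrays σ 9 ≡ A →
    i < N → q < N → eval candidate σ ≡ offer A i j q
  candidate-eval {σ} C refl refl refl refl i<N q<N = cong₂ _+_ (cong (λ f → f (registers σ 8)) (a₄≡ C))
    (cong₂ (λ y z → arrays σ 9 y + arrays σ 9 z) (pair-eval {σ} {e = reg 6} {reg 8} C refl refl i<N) (pair-eval {σ} {e = reg 8} {reg 7} C refl refl q<N))

  improve-runs : ∀ {i j A B} → i < N → ∀ q σ → q < n → registers σ 8 ≡ q → Searching i j A B q σ →
    Runs improve σ 0 (Searching i j A B (suc q))
  improve-runs {i} {j} {A} {B} i<N q σ q<n q≡ S = if-runs
    (λ nz → skip-runs (keep λ { x refl fits → contradiction (proj₂ (violation⇔ {σ} (context S) (reg-i S) (reg-j S) q≡) fits) nz }))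
    (λ z → if-runs
      (λ nz → assign-runs {δ = 0} {Q = λ σ′ → Searching i j A B (suc q) (setRegister 11 (eval (reg 8 ⊕ lit 1) σ′) σ′)}
        (replace (proj₁ (violation⇔ {σ} (context S) (reg-i S) (reg-j S) q≡) z) (m∸n≢0⇒n<m nz)) then assign-runs)
      (λ z′ → skip-runs (keep λ { x refl fits → subst (_≤ registers σ 10) cand≡ (m∸n≡0⇒m≤n z′) })))
    where
    cand≡ : eval candidate σ ≡ offer A i j q
    cand≡ = candidate-eval {σ} (context S) (reg-i S) (reg-j S) q≡ (table-A S) i<N (<-≤-trans q<n n≤N)
    keep : (∀ (x : Fin n) → toℕ x ≡ q → Fits i j (toℕ x) → offer A i j (toℕ x) ≤ registers σ 10) → Searching i j A B (suc q) σ
    keep new = record { Searching S hiding (best); best = record { Best (best S) hiding (≥all); ≥all = all } }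
      where
      all : ∀ (x : Fin n) → toℕ x < suc q → Fits i j (toℕ x) → offer A i j (toℕ x) ≤ registers σ 10
      all x x≤q fits with m≤n⇒m<n∨m≡n (s≤s⁻¹ x≤q)
      ... | inj₁ lt = ≥all (best S) x lt fits
      ... | inj₂ eq = new x eq fits
    replace : Fits i j q → registers σ 10 < eval candidate σ →
      Searching i j A B (suc q) (setRegister 11 (registers σ 8 + 1) (setRegister 10 (eval candidate σ) σ))
    replace fits lt = record { Searching S hiding (best); best = record
      { ≥old = ≤-trans (≥old (best S)) (<⇒≤ lt) ; ≥all = all ; found = inj₂ (fromℕ< q<n , arg≡ , fits′ , best≡) } }
      where
      q≡′ : q ≡ toℕ (fromℕ< q<n)
      q≡′ = sym (toℕ-fromℕ< q<n)
      arg≡ : registers σ 8 + 1 ≡ suc (toℕ (fromℕ< q<n))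
      arg≡ = trans (+-comm (registers σ 8) 1) (cong suc (trans q≡ q≡′))
      fits′ : Fits i j (toℕ (fromℕ< q<n))
      fits′ = subst (Fits i j) q≡′ fits
      best≡ : eval candidate σ ≡ offer A i j (toℕ (fromℕ< q<n))
      best≡ = trans cand≡ (cong (offer A i j) q≡′)
      all : ∀ (x : Fin n) → toℕ x < suc q → Fits i j (toℕ x) → offer A i j (toℕ x) ≤ eval candidate σ
      all x x≤q fits with m≤n⇒m<n∨m≡n (s≤s⁻¹ x≤q)
      ... | inj₁ lt′ = ≤-trans (≥all (best S) x lt′ fits) (<⇒≤ lt)
      ... | inj₂ refl = ≤-reflexive (sym cand≡)

  search-runs : ∀ {i j} → i < N → ∀ σ → registers σ 6 ≡ i → registers σ 7 ≡ j → ContextOf σ →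
    Runs search σ 1
      (Searching i j (arrays σ 9) (arrays σ 10) n)
  search-runs {i} {j} i<N σ i≡ j≡ C =
    assign-runs {Q = λ σ′ → Searching i j A B 0 (setRegister 11 0 σ′)} start then λ S₀ →
    assign-runs {Q = Searching i j A B 0} S₀ then λ S →
    for-runs (Searching i j A B) (λ ()) refl refl (λ _ _ _ S → record { Searching S }) (improve-runs i<N) (r₀≡ (context S)) n≤M S
    where
    A = arrays σ 9
    B = arrays σ 10
    start : Searching i j A B 0 (setRegister 11 0 (setRegister 10 (A (eval (pair (reg 6) (reg 7)) σ)) σ))
    start = record
      { reg-i = i≡ ; reg-j = j≡ ; context = C ; table-A = refl ; table-B = refl
      ; best = record { ≥old = ≤-reflexive (sym old) ; ≥all = λ _ () ; found = inj₁ (refl , old) } }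
      where
      old : A (eval (pair (reg 6) (reg 7)) σ) ≡ A (pairAt i j)
      old = cong A (pair-eval {σ} {e = reg 6} {reg 7} C i≡ j≡ i<N)

  -- The plan may have any height: entries need only be attained, while their optimality is left to
  -- `Complete`.
  Sound : Table → Table → Set
  Sound A B = ∀ i j → i < N → j < N → Σ (Plan i j) λ P →
    A (pairAt i j) ≡ total (Tasks.w tasks) P × (∀ x → nonzero (B (cellAt i j (toℕ x))) ≡ member P x)

  -- One-sided, since with in-place updates an entry may already exceed every plan of height r.
  Complete : ℕ → ℕ → ℕ → Table → Set
  Complete r i j A = ∀ (P : Plan i j) → height P ≤ r → total (Tasks.w tasks) P ≤ A (pairAt i j)

  complete-mono : ∀ {r i j A A′} → (∀ k → A k ≤ A′ k) → Complete r i j A → Complete r i j A′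
  complete-mono A≤A′ c P h = ≤-trans (c P h) (A≤A′ _)

  -- The Bellman step: the subtrees have height at most r, hence are bounded by the table, and the
  -- root was among the candidates searched.
  best⇒complete : ∀ {r i j A best arg} → (∀ i j → i < N → j < N → Complete r i j A) → i < N → j < N →
    Best A i j n best arg → (P : Plan i j) → height P ≤ suc r → total (Tasks.w tasks) P ≤ best
  best⇒complete c i<N j<N β empty _ = z≤n
  best⇒complete {A = A} c i<N j<N β (node q fits P Q) (s≤s h) = ≤-trans
    (+-mono-≤ (≤-reflexive (sym (w-task q)))
      (+-mono-≤ (c _ _ i<N (task<N q) P (m⊔n≤o⇒m≤o _ _ h)) (c _ _ (task<N q) j<N Q (m⊔n≤o⇒n≤o _ _ h))))
    (≥all β q (toℕ<n q) fits)

  -- With its mirror image this separates the cells (i, q) and (q, j) from (i, j), so `merge` may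
  -- read the former while the latter is being overwritten.
  fits⇒≢left : ∀ {i j} {q : Fin n} → Fits i j (toℕ q) → i ≢ toℕ q
  fits⇒≢left {q = q} ((pi≤sq , _) , _) refl = <⇒≱ (s<p q) pi≤sq

  fits⇒≢right : ∀ {i j} {q : Fin n} → Fits i j (toℕ q) → j ≢ toℕ q
  fits⇒≢right {q = q} (_ , (tq<pj , _) , _) refl = <⇒≱ tq<pj (p≤t q)

  -- Cells hold copies, not references: replacing the set of (i, j) leaves every set previously
  -- built from it intact. Only the plan for (i, j) changes.
  sound-update : ∀ {i j A B A′ B′} (q : Fin n) → i < N → j < N → Fits i j (toℕ q) → Sound A B →
    A′ (pairAt i j) ≡ offer A i j (toℕ q) → (∀ k → k ≢ pairAt i j → A′ k ≡ A k) →
    B′ (cellAt i j (toℕ q)) ≡ 1 →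
    (∀ y → y < n → y ≢ toℕ q → B′ (cellAt i j y) ≡ B (cellAt i (toℕ q) y) + B (cellAt (toℕ q) j y)) →
    (∀ k → (∀ y → y < n → k ≢ cellAt i j y) → B′ k ≡ B k) → Sound A′ B′
  sound-update {i} {j} {A} {B} {A′} {B′} q i<N j<N fits sound A′-new A′-old B′-q B′-new B′-old i′ j′ i′<N j′<N
    with sound i′ j′ i′<N j′<N | i′ ≟ i | j′ ≟ j
  ... | P , total≡ , member≡ | no i′≢i | _ = P ,
    trans (A′-old _ λ eq → i′≢i (proj₁ (pairAt-injective i′ i j′<N j<N eq))) total≡ ,
    λ x → trans (cong nonzero (B′-old _ λ y y<n eq → i′≢i (proj₁ (proj₁ (cellAt-injective i′ i j′<N j<N (task<N x) (<-≤-trans y<n n≤N) eq))))) (member≡ x)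
  ... | P , total≡ , member≡ | yes _ | no j′≢j = P ,
    trans (A′-old _ λ eq → j′≢j (proj₂ (pairAt-injective i′ i j′<N j<N eq))) total≡ ,
    λ x → trans (cong nonzero (B′-old _ λ y y<n eq → j′≢j (proj₂ (proj₁ (cellAt-injective i′ i j′<N j<N (task<N x) (<-≤-trans y<n n≤N) eq))))) (member≡ x)
  ... | _ | yes refl | yes refl with sound i (toℕ q) i<N (task<N q) | sound (toℕ q) j (task<N q) j<N
  ...   | P , totalP , memberP | Q , totalQ , memberQ = node q fits P Q ,
    trans A′-new (cong₂ _+_ (w-task q) (cong₂ _+_ totalP totalQ)) , members
    where
    members : ∀ x → nonzero (B′ (cellAt i j (toℕ x))) ≡ member (node q fits P Q) x
    members x with x Fin.≟ q
    ... | yes refl = cong nonzero B′-q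
    ... | no x≢q = trans (cong nonzero (B′-new (toℕ x) (toℕ<n x) (x≢q ∘ toℕ-injective)))
      (trans (nonzero-+ (B (cellAt i (toℕ q) (toℕ x))) _) (cong₂ _∨_ (memberP x) (memberQ x)))

  record Copying (i j q : ℕ) (A B : Table) (bound : ℕ) (σ : State) : Set where
    field
      reg-i   : registers σ 6 ≡ i
      reg-j   : registers σ 7 ≡ j
      reg-q   : registers σ 12 ≡ q
      context : ContextOf σ
      table-A : arrays σ 9 ≡ A
      copied  : ∀ y → y < bound → arrays σ 10 (cellAt i j y) ≡ B (cellAt i q y) + B (cellAt q j y)
      kept    : ∀ k → (∀ y → y < n → k ≢ cellAt i j y) → arrays σ 10 k ≡ B k

  module _ {i j : ℕ} (i<N : i < N) (j<N : j < N) {q : Fin n} (fits : Fits i j (toℕ q)) where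

    merge-runs : ∀ {A B} x σ → x < n → registers σ 9 ≡ x → Copying i j (toℕ q) A B x σ →
      Runs merge σ 0 (Copying i j (toℕ q) A B (suc x))
    merge-runs {A} {B} x σ x<n x≡ K = store-runs {δ = 0} (record
      { Copying K hiding (copied; kept) ; copied = copied′ ; kept = kept′ })
      where
      open Copying K using (copied; kept)
      C  = Copying.context K
      i≡ = Copying.reg-i K
      j≡ = Copying.reg-j K
      q≡ = Copying.reg-q K
      x<N : x < N
      x<N = <-≤-trans x<n n≤N
      target : ℕ
      target = eval (cell (reg 6) (reg 7) (reg 9)) σ
      target≡ : target ≡ cellAt i j x
      target≡ = cell-eval {σ} {e = reg 6} {reg 7} {reg 9} C i≡ j≡ x≡ i<N j<N
      source : ℕ
      source = arrays σ 10 (eval (cell (reg 6) (reg 12) (reg 9)) σ) + arrays σ 10 (eval (cell (reg 12) (reg 7) (reg 9)) σ)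
      source≡ : source ≡ B (cellAt i (toℕ q) x) + B (cellAt (toℕ q) j x)
      source≡ = cong₂ _+_
        (trans (cong (arrays σ 10) (cell-eval {σ} {e = reg 6} {reg 12} {reg 9} C i≡ q≡ x≡ i<N (task<N q)))
          (kept _ λ y y<n eq → fits⇒≢right {i} {j} {q} fits (sym (proj₂ (proj₁ (cellAt-injective i i (task<N q) j<N x<N (<-≤-trans y<n n≤N) eq))))))
        (trans (cong (arrays σ 10) (cell-eval {σ} {e = reg 12} {reg 7} {reg 9} C q≡ j≡ x≡ (task<N q) j<N))
          (kept _ λ y y<n eq → fits⇒≢left {i} {j} {q} fits (sym (proj₁ (proj₁ (cellAt-injective (toℕ q) i j<N j<N x<N (<-≤-trans y<n n≤N) eq))))))
      copied′ : ∀ y → y < suc x → update (arrays σ 10) target source (cellAt i j y) ≡ B (cellAt i (toℕ q) y) + B (cellAt (toℕ q) j y)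
      copied′ y y≤x with m≤n⇒m<n∨m≡n (s≤s⁻¹ y≤x)
      ... | inj₂ refl = trans (cong (update (arrays σ 10) target source) (sym target≡)) (trans (update-same (arrays σ 10) target source) source≡)
      ... | inj₁ y<x = trans (update-other (arrays σ 10) source λ eq → <⇒≢ y<x
        (proj₂ (cellAt-injective i i j<N j<N (<-trans y<x x<N) x<N (trans eq target≡)))) (copied y y<x)
      kept′ : ∀ k → (∀ y → y < n → k ≢ cellAt i j y) → update (arrays σ 10) target source k ≡ B k
      kept′ k k≢ = trans (update-other (arrays σ 10) source λ eq → k≢ x x<n (trans eq target≡)) (kept k k≢)

  record Relaxed (r i j : ℕ) (A : Table) (σ : State) : Set where
    field
      reg-i    : registers σ 6 ≡ i
      context  : ContextOf σ
      sound    : Sound (arrays σ 9) (arrays σ 10)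
      grows    : ∀ k → A k ≤ arrays σ 9 k
      complete : Complete (suc r) i j (arrays σ 9)

  record-choice-runs : ∀ {r i j A B σ} → i < N → j < N → Sound A B → (∀ i j → i < N → j < N → Complete r i j A) →
    Searching i j A B n σ → registers σ 11 ≢ 0 → Runs record-choice σ 1 (Relaxed r i j A)
  record-choice-runs {r} {i} {j} {A} {B} {σ} i<N j<N sound complete S nz with found (best S)
  ... | inj₁ (arg≡0 , _) = contradiction arg≡0 nz
  ... | inj₂ (q , arg≡ , fits , best≡) =
    assign-runs {Q = λ σ′ → σ′ ≡ σ₁} refl then λ { refl →
    store-runs {Q = Copying i j (toℕ q) A′ B 0} start then λ K₀ →
    for-runs (Copying i j (toℕ q) A′ B) (λ ()) refl refl (λ _ _ _ K → record { Copying K })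
      (λ x σ → merge-runs i<N j<N fits x σ) (r₀≡ (Copying.context K₀)) n≤M K₀ then λ {σ′} K → store-runs (finish σ′ K) }
    where
    σ₁ : State
    σ₁ = setRegister 12 (registers σ 11 ∸ 1) σ
    k₀ = eval (pair (reg 6) (reg 7)) σ₁
    k₀≡ : k₀ ≡ pairAt i j
    k₀≡ = pair-eval {σ} {e = reg 6} {reg 7} (context S) (reg-i S) (reg-j S) i<N
    A′ : Table
    A′ = update (arrays σ 9) k₀ (registers σ 10)
    A′-new : A′ (pairAt i j) ≡ registers σ 10
    A′-new = trans (cong A′ (sym k₀≡)) (update-same (arrays σ 9) k₀ _)
    A′-old : ∀ k → k ≢ pairAt i j → A′ k ≡ A k
    A′-old k k≢ = trans (update-other (arrays σ 9) _ λ eq → k≢ (trans eq k₀≡)) (cong (λ f → f k) (table-A S))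
    start : Copying i j (toℕ q) A′ B 0 (setEntry 9 k₀ (registers σ 10) σ₁)
    start = record
      { reg-i = reg-i S ; reg-j = reg-j S ; reg-q = cong (_∸ 1) arg≡ ; context = record { Context (context S) } ; table-A = refl
      ; copied = λ _ () ; kept = λ k _ → cong (λ f → f k) (table-B S) }
    finish : ∀ σ′ → Copying i j (toℕ q) A′ B n σ′ → Relaxed r i j A (setEntry 10 (eval (cell (reg 6) (reg 7) (reg 12)) σ′) 1 σ′)
    finish σ′ K = record
      { reg-i = Copying.reg-i K ; context = record { Context (Copying.context K) }
      ; sound = sound-update {B′ = B″} q i<N j<N fits sound
          (trans (cong (λ f → f (pairAt i j)) (Copying.table-A K)) (trans A′-new best≡))
          (λ k k≢ → trans (cong (λ f → f k) (Copying.table-A K)) (A′-old k k≢))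
          (trans (cong B″ (sym k₁≡)) (update-same (arrays σ′ 10) k₁ 1))
          (λ y y<n y≢q → trans (update-other (arrays σ′ 10) 1 λ eq → y≢q
            (proj₂ (cellAt-injective i i j<N j<N (<-≤-trans y<n n≤N) (task<N q) (trans eq k₁≡)))) (Copying.copied K y y<n))
          (λ k k≢ → trans (update-other (arrays σ′ 10) 1 λ eq → k≢ (toℕ q) (toℕ<n q) (trans eq k₁≡)) (Copying.kept K k k≢))
      ; grows = grows
      ; complete = λ P h → subst (total _ P ≤_) (sym (trans (cong (λ f → f (pairAt i j)) (Copying.table-A K)) A′-new))
          (best⇒complete complete i<N j<N (best S) P h) }
      where
      k₁ = eval (cell (reg 6) (reg 7) (reg 12)) σ′
      k₁≡ : k₁ ≡ cellAt i j (toℕ q)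
      k₁≡ = cell-eval {σ′} {e = reg 6} {reg 7} {reg 12} (Copying.context K) (Copying.reg-i K) (Copying.reg-j K) (Copying.reg-q K) i<N j<N
      B″ : Table
      B″ = update (arrays σ′ 10) k₁ 1
      grows : ∀ k → A k ≤ arrays σ′ 9 k
      grows k with k ≟ pairAt i j
      ... | yes refl = ≤-trans (≥old (best S)) (≤-reflexive (sym (trans (cong (λ f → f k) (Copying.table-A K)) A′-new)))
      ... | no k≢ = ≤-reflexive (sym (trans (cong (λ f → f k) (Copying.table-A K)) (A′-old k k≢)))

  relax-runs : ∀ {r i j} → i < N → j < N → ∀ σ → registers σ 6 ≡ i → registers σ 7 ≡ j → ContextOf σ →
    Sound (arrays σ 9) (arrays σ 10) → (∀ i j → i < N → j < N → Complete r i j (arrays σ 9)) →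
    Runs relax σ 1 (Relaxed r i j (arrays σ 9))
  relax-runs {r} {i} {j} i<N j<N σ i≡ j≡ C sound complete =
    search-runs i<N σ i≡ j≡ C then λ {σ′} S → if-runs (record-choice-runs i<N j<N sound complete S) (skip-runs ∘ unchanged σ′ S)
    where
    A = arrays σ 9
    unchanged : ∀ σ′ → Searching i j A (arrays σ 10) n σ′ → registers σ′ 11 ≡ 0 → Relaxed r i j A σ′
    unchanged σ′ S arg≡0 = record
      { reg-i = reg-i S ; context = context S ; sound = subst₂ Sound (sym (table-A S)) (sym (table-B S)) sound
      ; grows = λ k → ≤-reflexive (cong (λ f → f k) (sym (table-A S)))
      ; complete = λ P h → subst (λ f → total _ P ≤ f (pairAt i j)) (sym (table-A S))
          (subst (total _ P ≤_) best≡ (best⇒complete complete i<N j<N (best S) P h)) }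
      where
      best≡ : registers σ′ 10 ≡ A (pairAt i j)
      best≡ with found (best S)
      ... | inj₁ (_ , eq) = eq
      ... | inj₂ (_ , arg≡ , _) with () ← trans (sym arg≡0) arg≡

  AllComplete : ℕ → Table → Set
  AllComplete r A = ∀ i j → i < N → j < N → Complete r i j A

  -- Within round r the pairs preceding (i, j) in row-major order already handle height r + 1;
  -- `before` keeps the guarantee for height r that the pending pairs rely on.
  record InRow (r i j : ℕ) (σ : State) : Set where
    field
      reg-i   : registers σ 6 ≡ i
      context : ContextOf σ
      sound   : Sound (arrays σ 9) (arrays σ 10)
      before  : AllComplete r (arrays σ 9)
      rows    : ∀ i′ j′ → i′ < i → j′ < N → Complete (suc r) i′ j′ (arrays σ 9)
      columns : ∀ j′ → j′ < j → Complete (suc r) i j′ (arrays σ 9)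

  record InRound (r i : ℕ) (σ : State) : Set where
    field
      context : ContextOf σ
      sound   : Sound (arrays σ 9) (arrays σ 10)
      before  : AllComplete r (arrays σ 9)
      rows    : ∀ i′ j′ → i′ < i → j′ < N → Complete (suc r) i′ j′ (arrays σ 9)

  record AfterRound (r : ℕ) (σ : State) : Set where
    field
      context  : ContextOf σ
      sound    : Sound (arrays σ 9) (arrays σ 10)
      complete : AllComplete r (arrays σ 9)

  columns-run : ∀ {r i} → i < N → ∀ j σ → j < N → registers σ 7 ≡ j → InRow r i j σ → Runs relax σ 1 (InRow r i (suc j))
  columns-run {r} {i} i<N j σ j<N j≡ I = consequence next
    (relax-runs i<N j<N σ (InRow.reg-i I) j≡ (InRow.context I) (InRow.sound I) (InRow.before I))
    where
    next : ∀ {σ′} → Relaxed r i j (arrays σ 9) σ′ → InRow r i (suc j) σ′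
    next {σ′} R = record
      { reg-i = Relaxed.reg-i R ; context = Relaxed.context R ; sound = Relaxed.sound R
      ; before = λ i j i<N j<N → complete-mono {r} {i} {j} grows (InRow.before I i j i<N j<N)
      ; rows = λ i′ j′ i′<i j′<N → complete-mono {suc r} {i′} {j′} grows (InRow.rows I i′ j′ i′<i j′<N)
      ; columns = columns }
      where
      grows = Relaxed.grows R
      columns : ∀ j′ → j′ < suc j → Complete (suc r) i j′ (arrays σ′ 9)
      columns j′ j′≤j with m≤n⇒m<n∨m≡n (s≤s⁻¹ j′≤j)
      ... | inj₁ lt   = complete-mono {suc r} {i} {j′} grows (InRow.columns I j′ lt)
      ... | inj₂ refl = Relaxed.complete R

  rows-run : ∀ {r} i σ → i < N → registers σ 6 ≡ i → InRound r i σ →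
    Runs (for 7 below 2 ⟨ relax ⟩) σ 2 (InRound r (suc i))
  rows-run {r} i σ i<N i≡ I = consequence next
    (for-runs (InRow r i) (λ ()) refl refl (λ _ _ _ J → record { InRow J }) (columns-run i<N)
      (r₂≡ (InRound.context I)) N≤M (record { InRound I ; reg-i = i≡ ; columns = λ _ () }))
    where
    next : ∀ {σ′} → InRow r i N σ′ → InRound r (suc i) σ′
    next {σ′} J = record { InRow J hiding (rows; columns; reg-i) ; rows = rows }
      where
      rows : ∀ i′ j′ → i′ < suc i → j′ < N → Complete (suc r) i′ j′ (arrays σ′ 9)
      rows i′ j′ i′≤i j′<N with m≤n⇒m<n∨m≡n (s≤s⁻¹ i′≤i)
      ... | inj₁ lt   = InRow.rows J i′ j′ lt j′<N
      ... | inj₂ refl = InRow.columns J j′ j′<N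

  round-runs : ∀ r σ → AfterRound r σ → Runs (for 6 below 2 ⟨ for 7 below 2 ⟨ relax ⟩ ⟩) σ 3 (AfterRound (suc r))
  round-runs r σ I = consequence
    (λ J → record { InRound J hiding (before; rows) ; complete = λ i j i<N j<N → InRound.rows J i j i<N j<N })
    (for-runs (InRound r) (λ ()) refl refl (λ _ _ _ J → record { InRound J }) rows-run
      (r₂≡ (AfterRound.context I)) N≤M
      (record { AfterRound I hiding (complete) ; before = AfterRound.complete I ; rows = λ _ _ () }))

  rounds-run : ∀ {R σ} → registers σ 4 ≡ R → R ≤ M → ContextOf σ → (∀ k → arrays σ 9 k ≡ 0) → (∀ k → arrays σ 10 k ≡ 0) →
    Runs rounds σ 4 (AfterRound R)
  rounds-run {R} {σ} r₄≡ R≤M C A≡0 B≡0 = for-runs AfterRound (λ ()) refl refl (λ _ _ _ J → record { AfterRound J })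
    (λ r σ _ _ → round-runs r σ) r₄≡ R≤M (record
      { context = C
      ; sound = λ i j _ _ → empty , A≡0 _ , λ x → cong nonzero (B≡0 _)
      ; complete = λ { i j _ _ empty _ → z≤n } })

-- Preprocessing: peaks, outer walls and index offsets

locate : Program
locate = ifNonzero (load 1 (reg 6) ⊖ reg 9) ⊕ (reg 9 ⊕ lit 1 ⊖ load 2 (reg 6)) ⊕ (load 0 (reg 9) ⊕ lit 1 ⊖ load 0 (reg 12))
  ⟨ skip ∣ 12 ≔ reg 9 ⟩

peak : Program
peak =
  12 ≔ load 1 (reg 6) ⨾
  for 9 below 1 ⟨ locate ⟩ ⨾
  6 [ reg 6 ]≔ reg 12 ⊕ lit 1 ⨾
  7 [ reg 6 ]≔ load 0 (reg 12) ⨾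
  8 [ reg 6 ]≔ load 0 (reg 12) ⊖ load 3 (reg 6)

peaks : Program
peaks = for 6 below 0 ⟨ peak ⟩

-- The walls at either end of the path have the indices n, where all tables are zero, and n + 1.
walls : Program
walls =
  2 ≔ reg 0 ⊕ lit 2 ⨾
  4 ≔ reg 1 ⊕ lit 1 ⨾
  1 [ reg 0 ⊕ lit 1 ]≔ reg 1 ⨾
  6 [ reg 0 ⊕ lit 1 ]≔ reg 4

-- Multiplication by repeated addition. The table includes the entry at N, one beyond the row
-- indices: in array 11 it is N * N, the stride of array 12.
multiples : ℕ → ℕ → Program
multiples a r = for 6 below 2 ⟨ a [ reg 6 ⊕ lit 1 ]≔ load a (reg 6) ⊕ reg r ⟩

strides : Program
strides = multiples 11 2 ⨾ 3 ≔ load 11 (reg 2) ⨾ multiples 12 3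

publish : Program
publish = for 9 below 0 ⟨ 5 [ reg 9 ]≔ load 10 (cell (reg 0) (reg 0 ⊕ lit 1) (reg 9)) ⟩

algorithm : Program
algorithm = peaks ⨾ walls ⨾ strides ⨾ rounds ⨾ publish

zeroTable : ℕ → ℕ
zeroTable _ = 0

module Preparation (n m : ℕ) (u s t d w : ℕ → ℕ)
  (s<t : ∀ i → i < n → s i < t i) (t≤m : ∀ i → i < n → t i ≤ m)
  (M : ℕ) (1≤M : 1 ≤ M) (n≤M : n ≤ M) (m≤M : m ≤ M) (N≤M : n + 2 ≤ M) where
  open Logic M 1≤M

  record Peak (i e : ℕ) : Set where
    field
      s≤e      : s i ≤ e
      e<t      : e < t i
      least    : ∀ x → s i ≤ x → x < t i → u e ≤ u x
      leftmost : ∀ x → s i ≤ x → x < e → u e < u x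

  record Fixed (σ : State) : Set where
    field
      r₀≡  : registers σ 0 ≡ n
      r₁≡  : registers σ 1 ≡ m
      a₀≡  : arrays σ 0 ≡ u
      a₁≡  : arrays σ 1 ≡ s
      a₂≡  : arrays σ 2 ≡ t
      a₃≡  : arrays σ 3 ≡ d
      a₄≡  : arrays σ 4 ≡ w
      a₉≡  : arrays σ 9 ≡ zeroTable
      a₁₀≡ : arrays σ 10 ≡ zeroTable
      a₁₁≡ : arrays σ 11 ≡ zeroTable
      a₁₂≡ : arrays σ 12 ≡ zeroTable

  record Scanning (i : ℕ) (A₆ A₇ A₈ : ℕ → ℕ) (x : ℕ) (σ : State) : Set where
    field
      fixed    : Fixed σ
      reg-i    : registers σ 6 ≡ i
      a₆≡      : arrays σ 6 ≡ A₆
      a₇≡      : arrays σ 7 ≡ A₇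
      a₈≡      : arrays σ 8 ≡ A₈
      s≤e      : s i ≤ registers σ 12
      e<t      : registers σ 12 < t i
      least    : ∀ y → y < x → s i ≤ y → y < t i → u (registers σ 12) ≤ u y
      leftmost : ∀ y → s i ≤ y → y < registers σ 12 → u (registers σ 12) < u y

  -- The test vanishes exactly if i uses the edge x and `u x` is strictly below the current minimum;
  -- strictness is what keeps the minimum leftmost.
  locate-runs : ∀ {i A₆ A₇ A₈} x σ → x < m → registers σ 9 ≡ x → Scanning i A₆ A₇ A₈ x σ →
    Runs locate σ 0 (Scanning i A₆ A₇ A₈ (suc x))
  locate-runs {i} x σ x<m x≡ S = if-runs
    (λ nz → skip-runs (record { Scanning S hiding (least) ; least = least-kept nz }))
    (λ z → assign-runs {e = reg 9} (record
      { Scanning S hiding (s≤e; e<t; least; leftmost; fixed) ; fixed = record { Fixed fixed }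
      ; s≤e = subst (s i ≤_) (sym x≡) (s≤x z)
      ; e<t = subst (_< t i) (sym x≡) (x<t z)
      ; least = λ y y≤x si≤y y<ti → subst (λ e → u e ≤ u y) (sym x≡) (least-new z y y≤x si≤y y<ti)
      ; leftmost = λ y si≤y y<e → subst (λ e → u e < u y) (sym x≡) (leftmost-new z y si≤y (subst (y <_) x≡ y<e)) }))
    where
    open Scanning S
    e = registers σ 12
    v₁ = s i ∸ x
    v₂ = x + 1 ∸ t i
    v₃ = u x + 1 ∸ u e
    test : Expr
    test = (load 1 (reg 6) ⊖ reg 9) ⊕ (reg 9 ⊕ lit 1 ⊖ load 2 (reg 6)) ⊕ (load 0 (reg 9) ⊕ lit 1 ⊖ load 0 (reg 12))
    test≡ : eval test σ ≡ v₁ + v₂ + v₃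
    test≡ rewrite x≡ | reg-i | Fixed.a₀≡ fixed | Fixed.a₁≡ fixed | Fixed.a₂≡ fixed = refl
    module _ (z : eval test σ ≡ 0) where
      z₃ : v₁ + v₂ + v₃ ≡ 0
      z₃ = trans (sym test≡) z
      z₂ : v₁ + v₂ ≡ 0
      z₂ = m+n≡0⇒m≡0 (v₁ + v₂) z₃
      s≤x : s i ≤ x
      s≤x = m∸n≡0⇒m≤n (m+n≡0⇒m≡0 v₁ z₂)
      x<t : x < t i
      x<t = subst (_≤ t i) (+-comm x 1) (m∸n≡0⇒m≤n (m+n≡0⇒n≡0 v₁ z₂))
      lower : u x < u e
      lower = subst (_≤ u e) (+-comm (u x) 1) (m∸n≡0⇒m≤n (m+n≡0⇒n≡0 (v₁ + v₂) z₃))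
      leftmost-new : ∀ y → s i ≤ y → y < x → u x < u y
      -- Every edge of i scanned so far has capacity at least that of the old candidate, which x
      -- undercuts.
      leftmost-new y si≤y y<x = <-≤-trans lower (least y y<x si≤y (<-trans y<x x<t))
      least-new : ∀ y → y < suc x → s i ≤ y → y < t i → u x ≤ u y
      least-new y y≤x si≤y y<ti with m≤n⇒m<n∨m≡n (s≤s⁻¹ y≤x)
      ... | inj₁ y<x  = <⇒≤ (leftmost-new y si≤y y<x)
      ... | inj₂ refl = ≤-refl
    least-kept : eval test σ ≢ 0 → ∀ y → y < suc x → s i ≤ y → y < t i → u e ≤ u y
    least-kept nz y y≤x si≤y y<ti with m≤n⇒m<n∨m≡n (s≤s⁻¹ y≤x)
    ... | inj₁ y<x = least y y<x si≤y y<ti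
    ... | inj₂ refl with u e ≤? u y
    ...   | yes p = p
    ...   | no ¬p = contradiction (trans test≡ (cong₂ _+_ (cong₂ _+_ (m≤n⇒m∸n≡0 si≤y)
      (m≤n⇒m∸n≡0 (subst (_≤ t i) (+-comm 1 y) y<ti))) (m≤n⇒m∸n≡0 (subst (_≤ u e) (+-comm 1 (u y)) (≰⇒> ¬p))))) nz

  Entry : ℕ → ℕ → ℕ → ℕ → Set
  Entry i P B L = Σ ℕ λ e → Peak i e × P ≡ suc e × B ≡ u e × L ≡ u e ∸ d i

  record Prepared (bound : ℕ) (σ : State) : Set where
    field
      fixed   : Fixed σ
      entries : ∀ i → i < bound → Entry i (arrays σ 6 i) (arrays σ 7 i) (arrays σ 8 i)
      zeros   : ∀ i → bound ≤ i → arrays σ 6 i ≡ 0 × arrays σ 7 i ≡ 0 × arrays σ 8 i ≡ 0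

  peak-runs : ∀ i σ → i < n → registers σ 6 ≡ i → Prepared i σ → Runs peak σ 1 (Prepared (suc i))
  peak-runs i σ i<n i≡ R =
    assign-runs {Q = Scanning i A₆ A₇ A₈ 0} start then λ S₀ →
    for-runs (Scanning i A₆ A₇ A₈) (λ ()) refl refl
      (λ _ _ _ S → record { Scanning S hiding (fixed) ; fixed = record { Fixed (Scanning.fixed S) } })
      locate-runs (Fixed.r₁≡ (Scanning.fixed S₀)) m≤M S₀ then λ {σ₁} S →
    store-runs {Q = λ σ′ → σ′ ≡ s₁ σ₁} refl then λ { refl →
    store-runs {Q = λ σ′ → σ′ ≡ s₂ σ₁} refl then λ { refl →
    store-runs (finish σ₁ S) } }
    where
    A₆ = arrays σ 6
    A₇ = arrays σ 7
    A₈ = arrays σ 8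
    s₁ s₂ : State → State
    s₁ σ₁ = setEntry 6 (registers σ₁ 6) (registers σ₁ 12 + 1) σ₁
    s₂ σ₁ = setEntry 7 (registers σ₁ 6) (arrays σ₁ 0 (registers σ₁ 12)) (s₁ σ₁)
    start≡ : arrays σ 1 (registers σ 6) ≡ s i
    start≡ = trans (cong (λ f → f (registers σ 6)) (Fixed.a₁≡ (Prepared.fixed R))) (cong s i≡)
    start : Scanning i A₆ A₇ A₈ 0 (setRegister 12 (arrays σ 1 (registers σ 6)) σ)
    start = record
      { fixed = record { Fixed (Prepared.fixed R) } ; reg-i = i≡ ; a₆≡ = refl ; a₇≡ = refl ; a₈≡ = refl
      ; s≤e = ≤-reflexive (sym start≡) ; e<t = subst (_< t i) (sym start≡) (s<t i i<n)
      ; least = λ _ () ; leftmost = λ y si≤y y<e → contradiction si≤y (<⇒≱ (subst (y <_) start≡ y<e)) }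
    finish : ∀ σ₁ → Scanning i A₆ A₇ A₈ m σ₁ → Prepared (suc i)
      (setEntry 8 (registers σ₁ 6) (arrays σ₁ 0 (registers σ₁ 12) ∸ arrays σ₁ 3 (registers σ₁ 6)) (s₂ σ₁))
    finish σ₁ S = record { fixed = record { Fixed fixed } ; entries = entries ; zeros = zeros }
      where
      open Scanning S
      e = registers σ₁ 12
      A₀ = arrays σ₁ 0
      j = registers σ₁ 6
      L = A₀ e ∸ arrays σ₁ 3 j
      B₆ = update (arrays σ₁ 6) j (e + 1)
      B₇ = update (arrays σ₁ 7) j (A₀ e)
      B₈ = update (arrays σ₁ 8) j L
      other₆ : ∀ {k} → k ≢ i → B₆ k ≡ A₆ k
      other₆ {k} k≢i = trans (update-other (arrays σ₁ 6) (e + 1) λ eq → k≢i (trans eq reg-i)) (cong (λ f → f k) a₆≡)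
      other₇ : ∀ {k} → k ≢ i → B₇ k ≡ A₇ k
      other₇ {k} k≢i = trans (update-other (arrays σ₁ 7) (A₀ e) λ eq → k≢i (trans eq reg-i)) (cong (λ f → f k) a₇≡)
      other₈ : ∀ {k} → k ≢ i → B₈ k ≡ A₈ k
      other₈ {k} k≢i = trans (update-other (arrays σ₁ 8) L λ eq → k≢i (trans eq reg-i)) (cong (λ f → f k) a₈≡)
      A₀≡ : A₀ e ≡ u e
      A₀≡ = cong (λ f → f e) (Fixed.a₀≡ fixed)
      entries : ∀ k → k < suc i → Entry k (B₆ k) (B₇ k) (B₈ k)
      entries k k≤i with k ≟ i
      ... | yes refl = e , record
        { s≤e = s≤e ; e<t = e<t ; least = λ x si≤x x<ti → least x (<-≤-trans x<ti (t≤m i i<n)) si≤x x<ti ; leftmost = leftmost } ,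
        trans (trans (cong B₆ (sym reg-i)) (update-same (arrays σ₁ 6) j (e + 1))) (+-comm e 1) ,
        trans (trans (cong B₇ (sym reg-i)) (update-same (arrays σ₁ 7) j (A₀ e))) A₀≡ ,
        trans (trans (cong B₈ (sym reg-i)) (update-same (arrays σ₁ 8) j L))
          (cong₂ _∸_ A₀≡ (trans (cong (λ f → f j) (Fixed.a₃≡ fixed)) (cong d reg-i)))
      ... | no k≢i with Prepared.entries R k (≤∧≢⇒< (s≤s⁻¹ k≤i) k≢i)
      ...   | e′ , pk , eq₆ , eq₇ , eq₈ = e′ , pk , trans (other₆ k≢i) eq₆ , trans (other₇ k≢i) eq₇ , trans (other₈ k≢i) eq₈
      zeros : ∀ k → suc i ≤ k → B₆ k ≡ 0 × B₇ k ≡ 0 × B₈ k ≡ 0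
      zeros k i<k with Prepared.zeros R k (<⇒≤ i<k) | >⇒≢ i<k
      ... | eq₆ , eq₇ , eq₈ | k≢i = trans (other₆ k≢i) eq₆ , trans (other₇ k≢i) eq₇ , trans (other₈ k≢i) eq₈

  peaks-run : ∀ {σ} → Prepared 0 σ → Runs peaks σ 2 (Prepared n)
  peaks-run R = for-runs Prepared (λ ()) refl refl
    (λ _ _ _ R → record { Prepared R hiding (fixed) ; fixed = record { Fixed (Prepared.fixed R) } })
    peak-runs (Fixed.r₀≡ (Prepared.fixed R)) n≤M R

  multiples-run : ∀ {N a r σ} → r ≢ 6 → registers σ 2 ≡ N → N ≤ M → arrays σ a 0 ≡ 0 →
    Runs (multiples a r) σ 1 (λ σ′ → (∀ i → i ≤ N → arrays σ′ a i ≡ i * registers σ r) ×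
      (∀ a′ → a′ ≢ a → arrays σ′ a′ ≡ arrays σ a′) × (∀ y → y ≢ 6 → registers σ′ y ≡ registers σ y))
  multiples-run {N} {a} {r} {σ} r≢6 r₂≡ N≤M′ a≡0 = consequence (λ (f , rest) → (λ i le → f i le) , rest)
    (for-runs Inv (λ ()) refl refl stable step r₂≡ N≤M′
      ((λ { zero _ → a≡0 }) , (λ _ _ → refl) , λ _ _ → refl))
    where
    Inv : ℕ → State → Set
    Inv x σ′ = (∀ i → i ≤ x → arrays σ′ a i ≡ i * registers σ r) ×
      (∀ a′ → a′ ≢ a → arrays σ′ a′ ≡ arrays σ a′) × (∀ y → y ≢ 6 → registers σ′ y ≡ registers σ y)
    stable : ∀ x σ′ v → Inv x σ′ → Inv x (setRegister 6 v σ′)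
    stable x σ′ v (f , g , h) = f , g , λ y y≢6 → trans (update-other (registers σ′) v y≢6) (h y y≢6)
    step : ∀ x σ′ → x < N → registers σ′ 6 ≡ x → Inv x σ′ →
      Runs (a [ reg 6 ⊕ lit 1 ]≔ load a (reg 6) ⊕ reg r) σ′ 0 (Inv (suc x))
    step x σ′ _ x≡ (f , g , h) = store-runs {e = reg 6 ⊕ lit 1} {f = load a (reg 6) ⊕ reg r}
      (f′ , (λ a′ a′≢a → trans (update-other (arrays σ′) _ a′≢a) (g a′ a′≢a)) , h)
      where
      k = registers σ′ 6 + 1
      v = arrays σ′ a (registers σ′ 6) + registers σ′ r
      k≡ : k ≡ suc x
      k≡ = trans (+-comm (registers σ′ 6) 1) (cong suc x≡)
      v≡ : v ≡ suc x * registers σ r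
      v≡ = trans (+-comm _ (registers σ′ r)) (cong₂ _+_ (h r r≢6) (trans (cong (arrays σ′ a) x≡) (f x ≤-refl)))
      f′ : ∀ i → i ≤ suc x → update (arrays σ′) a (update (arrays σ′ a) k v) a i ≡ i * registers σ r
      f′ i i≤ rewrite update-same (arrays σ′) a (update (arrays σ′ a) k v) with m≤n⇒m<n∨m≡n i≤
      ... | inj₁ lt   = trans (update-other (arrays σ′ a) v λ eq → <⇒≢ lt (trans eq k≡)) (f i (s≤s⁻¹ lt))
      ... | inj₂ refl = trans (cong (update (arrays σ′ a) k v) (sym k≡)) (trans (update-same (arrays σ′ a) k v) v≡)

-- From instances to tables, and the resulting approximation algorithm

open ℤ using (+_)

zeroExtend-toℕ : ∀ {n} (f : Fin n → ℕ) i → zeroExtend f (toℕ i) ≡ f i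
zeroExtend-toℕ {n} f i with toℕ i <? n
... | yes lt = cong f (fromℕ<-toℕ i lt)
... | no ¬lt = contradiction (toℕ<n i) ¬lt

zeroExtend-≥ : ∀ {n} (f : Fin n → ℕ) {j} → n ≤ j → zeroExtend f j ≡ 0
zeroExtend-≥ {n} f {j} n≤j with j <? n
... | yes lt = contradiction n≤j (<⇒≱ lt)
... | no _   = refl

module _ (I : Instance) where
  open Instance I

  -- `covered` picks a task and a side for each vertex, and the vertex can be recovered from them.
  -- This injection is where m becomes O(n).
  vertices≤endpoints : suc numEdges ≤ numTasks + numTasks
  vertices≤endpoints = injective⇒≤ {f = join numTasks numTasks ∘ side} λ {v} {v′} eq →
    trans (sym (endpoint-side v)) (trans (cong endpoint (trans (sym (splitAt-join _ _ (side v)))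
      (trans (cong (splitAt numTasks) eq) (splitAt-join _ _ (side v′))))) (endpoint-side v′))
    where
    endpoint : Fin numTasks ⊎ Fin numTasks → Fin (suc numEdges)
    endpoint = [ start , end ]′
    side : Fin (suc numEdges) → Fin numTasks ⊎ Fin numTasks
    side v with covered v
    ... | i , inj₁ _ = inj₁ i
    ... | i , inj₂ _ = inj₂ i
    endpoint-side : ∀ v → endpoint (side v) ≡ v
    endpoint-side v with covered v
    ... | i , inj₁ eq = sym eq
    ... | i , inj₂ eq = sym eq

  numTasks>0 : 1 ≤ numTasks
  numTasks>0 = ≤-trans (s≤s z≤n) (toℕ<n (proj₁ (covered zero)))

  -- Applied to the capacity v of the computed peak, it transfers largeness from `bottleneck` to
  -- `b`.
  below-bottleneck : ∀ i {v} → (∀ e → Uses I i e → v ≤ capacity e) → v ≤ bottleneck I i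
  below-bottleneck i {v} h = v≤min⁺ (h (firstEdge I i) first-used) (Allₚ.map⁺ (All.map (h _) (Allₚ.all-filter (uses? I i) (allFin numEdges))))
    where
    first≡ : toℕ (firstEdge I i) ≡ toℕ (start i)
    first≡ = toℕ-fromℕ< _
    first-used : Uses I i (firstEdge I i)
    first-used = ≤-reflexive (sym first≡) , subst (_< toℕ (end i)) (sym first≡) (start<end i)

  -- The order on unnormalised rationals is cross-multiplication; `lhs` and `rhs` reduce its two
  -- sides to k times the demand and the bottleneck.
  large⇒bottleneck< : ∀ k .{{_ : NonZero k}} i → Large I (+ 1 / k) i → bottleneck I i < k * demand i
  large⇒bottleneck< k@(suc _) i large = ≰⇒> λ kd≤b → large (*≤* (subst₂ ℤ._≤_ (lhs k) (rhs (bottleneck I i)) (+≤+ kd≤b)))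
    where
    lhs : ∀ k → + (k * demand i) ≡ + demand i ℤ.* + (k * 1)
    lhs k = trans (cong +_ (trans (*-comm k (demand i)) (cong (demand i *_) (sym (*-identityʳ k))))) (ℤₚ.pos-* (demand i) (k * 1))
    rhs : ∀ b → + b ≡ + 1 ℤ.* + b ℤ.* + 1
    rhs b = sym (trans (ℤₚ.*-identityʳ _) (ℤₚ.*-identityˡ (+ b)))

module Correctness (I : Instance) where
  open Instance I

  n m M : ℕ
  n = numTasks
  m = numEdges
  -- A common bound for all loop lengths: `m + 1 ≤ 2 * n`, and `n + 2 ≤ 3 * n` because n is
  -- positive.
  M = 3 * n

  u s t d w : ℕ → ℕ
  u = zeroExtend capacity
  s = zeroExtend (λ i → toℕ (start i))
  t = zeroExtend (λ i → toℕ (end i))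
  d = zeroExtend demand
  w = zeroExtend profit

  1≤n : 1 ≤ n
  1≤n = numTasks>0 I

  1≤M : 1 ≤ M
  1≤M = ≤-trans 1≤n (m≤m+n n _)

  n≤M : n ≤ M
  n≤M = m≤m+n n _

  m+1≤M : m + 1 ≤ M
  m+1≤M = ≤-trans (≤-reflexive (+-comm m 1)) (≤-trans (vertices≤endpoints I) (+-monoʳ-≤ n (m≤m+n n _)))

  m≤M : m ≤ M
  m≤M = ≤-trans (m≤m+n m 1) m+1≤M

  N≤M : n + 2 ≤ M
  N≤M = +-monoʳ-≤ n (+-mono-≤ 1≤n (≤-trans 1≤n (m≤m+n n 0)))

  at : ∀ {ℓ} (P : ℕ → Set ℓ) → (∀ (q : Fin n) → P (toℕ q)) → ∀ i → i < n → P i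
  at P h i i<n = subst P (toℕ-fromℕ< i<n) (h (fromℕ< i<n))

  s-toℕ : ∀ q → s (toℕ q) ≡ toℕ (start q)
  s-toℕ = zeroExtend-toℕ (λ i → toℕ (start i))

  t-toℕ : ∀ q → t (toℕ q) ≡ toℕ (end q)
  t-toℕ = zeroExtend-toℕ (λ i → toℕ (end i))

  s<t : ∀ i → i < n → s i < t i
  s<t = at (λ i → s i < t i) λ q → subst₂ _<_ (sym (s-toℕ q)) (sym (t-toℕ q)) (start<end q)

  end≤m : ∀ q → toℕ (end q) ≤ m
  end≤m q = toℕ≤pred[n] (end q)

  t≤m : ∀ i → i < n → t i ≤ m
  t≤m = at (λ i → t i ≤ m) λ q → subst (_≤ m) (sym (t-toℕ q)) (end≤m q)

  open Logic M 1≤M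
  open Preparation n m u s t d w s<t t≤m M 1≤M n≤M m≤M N≤M

  prepared : Prepared 0 (input I)
  prepared = record
    { fixed = record { r₀≡ = refl ; r₁≡ = refl ; a₀≡ = refl ; a₁≡ = refl ; a₂≡ = refl ; a₃≡ = refl ; a₄≡ = refl
                     ; a₉≡ = refl ; a₁₀≡ = refl ; a₁₁≡ = refl ; a₁₂≡ = refl }
    ; entries = λ _ () ; zeros = λ _ _ → refl , refl , refl }

  record Walled (σ : State) : Set where
    field
      r₀≡     : registers σ 0 ≡ n
      r₂≡     : registers σ 2 ≡ n + 2
      r₄≡     : registers σ 4 ≡ m + 1
      a₂≡     : arrays σ 2 ≡ t
      a₃≡     : arrays σ 3 ≡ d
      a₄≡     : arrays σ 4 ≡ w
      a₉≡     : arrays σ 9 ≡ zeroTable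
      a₁₀≡    : arrays σ 10 ≡ zeroTable
      a₁₁≡    : arrays σ 11 ≡ zeroTable
      a₁₂≡    : arrays σ 12 ≡ zeroTable
      starts  : ∀ i → i < n → arrays σ 1 i ≡ s i
      entries : ∀ i → i < n → Entry i (arrays σ 6 i) (arrays σ 7 i) (arrays σ 8 i)
      left    : arrays σ 6 n ≡ 0
      right   : arrays σ 1 (n + 1) ≡ m × arrays σ 6 (n + 1) ≡ m + 1
      floor   : ∀ i → n ≤ i → arrays σ 7 i ≡ 0 × arrays σ 8 i ≡ 0

  walls-run : ∀ {σ} → Prepared n σ → Runs walls σ 0 Walled
  walls-run {σ} R =
    assign-runs {Q = _≡ σ₁} refl then λ { refl →
    assign-runs {Q = _≡ σ₂} refl then λ { refl →
    store-runs {Q = _≡ σ₃} refl then λ { refl →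
    store-runs (record
      { r₀≡ = r₀≡ ; r₂≡ = cong (_+ 2) r₀≡ ; r₄≡ = cong (_+ 1) r₁≡
      ; a₂≡ = a₂≡ ; a₃≡ = a₃≡ ; a₄≡ = a₄≡ ; a₉≡ = a₉≡ ; a₁₀≡ = a₁₀≡ ; a₁₁≡ = a₁₁≡ ; a₁₂≡ = a₁₂≡
      ; starts = λ i i<n → trans (update-other (arrays σ 1) _ (i≢k (<⇒≢ (<-≤-trans i<n (m≤m+n n 1))))) (cong (λ f → f i) a₁≡)
      ; entries = λ i i<n → entry i (Prepared.entries R i i<n) (update-other (arrays σ 6) v (i≢k (<⇒≢ (<-≤-trans i<n (m≤m+n n 1)))))
      ; left = trans (update-other (arrays σ 6) v (i≢k (m≢1+m+n n ∘ λ eq → trans eq (trans (+-comm n 1) (cong suc (sym (+-identityʳ n)))))))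
          (proj₁ (Prepared.zeros R n ≤-refl))
      ; right = trans (cong (update (arrays σ 1) k (registers σ 1)) (sym k≡)) (trans (update-same (arrays σ 1) k _) r₁≡)
              , trans (cong (update (arrays σ 6) k v) (sym k≡)) (trans (update-same (arrays σ 6) k v) (cong (_+ 1) r₁≡))
      ; floor = λ i n≤i → proj₂ (Prepared.zeros R i n≤i) }) } } }
    where
    open Fixed (Prepared.fixed R)
    k = registers σ 0 + 1
    v = registers σ 1 + 1
    k≡ : k ≡ n + 1
    k≡ = cong (_+ 1) r₀≡
    σ₁ = setRegister 2 (registers σ 0 + 2) σ
    σ₂ = setRegister 4 v σ₁
    σ₃ = setEntry 1 k (registers σ 1) σ₂
    i≢k : ∀ {i} → i ≢ n + 1 → i ≢ k
    i≢k h eq = h (trans eq k≡)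
    entry : ∀ i {x y b ℓ} → Entry i x b ℓ → y ≡ x → Entry i y b ℓ
    entry i E refl = E

  -- Freezes the arrays left by `walls` as a `Layout`. The later phases write only to arrays 5 and 9
  -- to 12, which it does not mention.
  module Layed (σ₁ : State) (W : Walled σ₁) where
    open Walled W

    module _ (q : Fin n) where
      entry : Entry (toℕ q) (arrays σ₁ 6 (toℕ q)) (arrays σ₁ 7 (toℕ q)) (arrays σ₁ 8 (toℕ q))
      entry = entries (toℕ q) (toℕ<n q)
      top : ℕ
      top = proj₁ entry
      open Peak (proj₁ (proj₂ entry)) public

    tasks : Tasks n m u
    tasks = record
      { s = λ q → toℕ (start q) ; t = λ q → toℕ (end q) ; d = demand ; w = profit ; e = top
      ; s≤e = λ q → subst (_≤ top q) (s-toℕ q) (s≤e q)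
      ; e<t = λ q → subst (top q <_) (t-toℕ q) (e<t q)
      ; t≤m = end≤m
      ; d>0 = demand>0
      ; least = λ q x s≤x x<t → least q x (subst (_≤ x) (sym (s-toℕ q)) s≤x) (subst (x <_) (sym (t-toℕ q)) x<t)
      ; leftmost = λ q x s≤x x<e → leftmost q x (subst (_≤ x) (sym (s-toℕ q)) s≤x) x<e }

    Λ : Layout n m u
    Λ = record
      { tasks = tasks
      ; s = arrays σ₁ 1 ; t = arrays σ₁ 2 ; d = arrays σ₁ 3 ; w = arrays σ₁ 4
      ; p = arrays σ₁ 6 ; b = arrays σ₁ 7 ; ℓ = arrays σ₁ 8
      ; s-task = λ q → trans (starts (toℕ q) (toℕ<n q)) (s-toℕ q)
      ; t-task = λ q → trans (cong (λ f → f (toℕ q)) a₂≡) (t-toℕ q)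
      ; d-task = λ q → trans (cong (λ f → f (toℕ q)) a₃≡) (zeroExtend-toℕ demand q)
      ; w-task = λ q → trans (cong (λ f → f (toℕ q)) a₄≡) (zeroExtend-toℕ profit q)
      ; p-task = λ q → proj₁ (proj₂ (proj₂ (entry q)))
      ; b-task = λ q → proj₁ (proj₂ (proj₂ (proj₂ (entry q))))
      ; ℓ-task = λ q → trans (proj₂ (proj₂ (proj₂ (proj₂ (entry q))))) (cong (u (top q) ∸_) (zeroExtend-toℕ demand q)) }

    open Planning Λ
    open DynamicProgram Λ M 1≤M n≤M N≤M
    private module T = Tasks tasks

    record Ready (σ : State) : Set where
      field
        r₄≡     : registers σ 4 ≡ m + 1
        context : ContextOf σ
        zeros   : (∀ k → arrays σ 9 k ≡ 0) × (∀ k → arrays σ 10 k ≡ 0)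

    strides-run : Runs strides σ₁ 1 Ready
    strides-run =
      multiples-run {a = 11} (λ ()) r₂≡ N≤M (cong (λ f → f 0) a₁₁≡) then λ {σ} (f , g , h) →
      assign-runs {Q = _≡ setRegister 3 (arrays σ 11 (registers σ 2)) σ} refl then λ { refl →
      consequence (λ {σ′} (f′ , g′ , h′) → ready σ σ′ f g h f′ g′ h′)
        (multiples-run {a = 12} (λ ()) (trans (h 2 λ ()) r₂≡) N≤M (cong (λ f → f 0) (trans (g 12 λ ()) a₁₂≡))) }
      where
      ready : ∀ σ σ′ → (∀ i → i ≤ n + 2 → arrays σ 11 i ≡ i * registers σ₁ 2) →
        (∀ a → a ≢ 11 → arrays σ a ≡ arrays σ₁ a) → (∀ y → y ≢ 6 → registers σ y ≡ registers σ₁ y) →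
        (∀ i → i ≤ n + 2 → arrays σ′ 12 i ≡ i * arrays σ 11 (registers σ 2)) →
        (∀ a → a ≢ 12 → arrays σ′ a ≡ arrays σ a) →
        (∀ y → y ≢ 6 → registers σ′ y ≡ update (registers σ) 3 (arrays σ 11 (registers σ 2)) y) → Ready σ′
      ready σ σ′ f g h f′ g′ h′ = record
        { r₄≡ = trans (h′ 4 λ ()) (trans (h 4 λ ()) r₄≡)
        ; context = record
          { r₀≡ = trans (h′ 0 λ ()) (trans (h 0 λ ()) r₀≡)
          ; r₂≡ = trans (h′ 2 λ ()) r₂≡′
          ; a₁≡ = trans (g′ 1 λ ()) (g 1 λ ())
          ; a₂≡ = trans (g′ 2 λ ()) (g 2 λ ())
          ; a₃≡ = trans (g′ 3 λ ()) (g 3 λ ())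
          ; a₄≡ = trans (g′ 4 λ ()) (g 4 λ ())
          ; a₆≡ = trans (g′ 6 λ ()) (g 6 λ ())
          ; a₇≡ = trans (g′ 7 λ ()) (g 7 λ ())
          ; a₈≡ = trans (g′ 8 λ ()) (g 8 λ ())
          ; a₁₁≡ = λ i i<N → trans (cong (λ f → f i) (g′ 11 λ ())) (row i (<⇒≤ i<N))
          ; a₁₂≡ = λ i i<N → trans (f′ i (<⇒≤ i<N)) (cong (i *_) (trans (cong (arrays σ 11) r₂≡′) (row (n + 2) ≤-refl))) }
        ; zeros = (λ k → cong (λ f → f k) (trans (g′ 9 λ ()) (trans (g 9 λ ()) a₉≡)))
                , (λ k → cong (λ f → f k) (trans (g′ 10 λ ()) (trans (g 10 λ ()) a₁₀≡))) }
        where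
        r₂≡′ : registers σ 2 ≡ n + 2
        r₂≡′ = trans (h 2 λ ()) r₂≡
        row : ∀ i → i ≤ n + 2 → arrays σ 11 i ≡ i * (n + 2)
        row i le = trans (f i le) (cong (i *_) r₂≡)

    n<N : n < n + 2
    n<N = m<m+n n (s≤s z≤n)

    n+1<N : n + 1 < n + 2
    n+1<N = +-monoʳ-< n (s≤s (s≤s z≤n))

    Published : Table → ℕ → State → Set
    Published B x σ = ∀ y → y < x → arrays σ 5 y ≡ B (cellAt n (n + 1) y)

    record Publishing (B : Table) (x : ℕ) (σ : State) : Set where
      field
        context   : ContextOf σ
        table-B   : arrays σ 10 ≡ B
        published : Published B x σ

    publish-runs : ∀ {σ} → ContextOf σ → Runs publish σ 1 (Publishing (arrays σ 10) n)
    publish-runs {σ} C = for-runs (Publishing B) (λ ()) refl refl (λ _ _ _ K → record { Publishing K }) step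
      (Context.r₀≡ C) n≤M (record { context = C ; table-B = refl ; published = λ _ () })
      where
      B = arrays σ 10
      step : ∀ x σ′ → x < n → registers σ′ 9 ≡ x → Publishing B x σ′ →
        Runs (5 [ reg 9 ]≔ load 10 (cell (reg 0) (reg 0 ⊕ lit 1) (reg 9))) σ′ 0 (Publishing B (suc x))
      step x σ′ x<n x≡ K = store-runs (record { context = record { Context context } ; table-B = table-B ; published = published′ })
        where
        open Publishing K
        v = arrays σ′ 10 (eval (cell (reg 0) (reg 0 ⊕ lit 1) (reg 9)) σ′)
        v≡ : v ≡ B (cellAt n (n + 1) x)
        v≡ = trans (cong (arrays σ′ 10) (cell-eval {σ′} {e = reg 0} {reg 0 ⊕ lit 1} {reg 9} context
          (Context.r₀≡ context) (cong (_+ 1) (Context.r₀≡ context)) x≡ n<N n+1<N)) (cong (λ f → f _) table-B)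
        published′ : ∀ y → y < suc x → update (arrays σ′ 5) (registers σ′ 9) v y ≡ B (cellAt n (n + 1) y)
        published′ y y≤x with m≤n⇒m<n∨m≡n (s≤s⁻¹ y≤x)
        ... | inj₁ lt = trans (update-other (arrays σ′ 5) v λ eq → <⇒≢ lt (trans eq x≡)) (published y lt)
        ... | inj₂ refl = trans (cong (update (arrays σ′ 5) (registers σ′ 9) v) (sym x≡)) (trans (update-same (arrays σ′ 5) (registers σ′ 9) v) v≡)

    through-load : ∀ F e → sumOver (F ∩ tasksUsing I e) demand ≡ sumOn (T.through (lookup F) (toℕ e)) demand
    through-load F e = sum-cong-≗ λ i → cong (λ z → if z then demand i else 0)
      (trans (lookup-zipWith _∧_ i F (tasksUsing I e)) (cong (lookup F i ∧_) (lookup∘tabulate _ i)))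

    feasible⇒packs : ∀ F → Feasible I F → T.Packs (lookup F)
    feasible⇒packs F feasible x x<m = subst (λ x → sumOn (T.through (lookup F) x) demand ≤ u x) (toℕ-fromℕ< x<m)
      (subst₂ _≤_ (through-load F (fromℕ< x<m)) (sym (zeroExtend-toℕ capacity (fromℕ< x<m))) (feasible (fromℕ< x<m)))

    packs⇒feasible : ∀ F → T.Packs (lookup F) → Feasible I F
    packs⇒feasible F packs e = subst₂ _≤_ (sym (through-load F e)) (zeroExtend-toℕ capacity e) (packs (toℕ e) (toℕ<n e))

    packs-cong : ∀ {S S′ : Fin n → Bool} → (∀ i → S i ≡ S′ i) → T.Packs S → T.Packs S′
    packs-cong {S} {S′} eq packs x x<m = subst (_≤ u x)
      (sum-cong-≗ λ i → cong (λ z → if z ∧ does (T.covers? i x) then demand i else 0) (eq i)) (packs x x<m)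

    module _ (k : ℕ) .{{_ : NonZero k}} (large : ∀ i → Large I (+ 1 / k) i) where
      open Colouring tasks

      top<demand : ∀ i → T.b i < k * demand i
      top<demand i = ≤-<-trans (below-bottleneck I i λ e (s≤e , e<t) →
        subst (T.b i ≤_) (zeroExtend-toℕ capacity e) (T.least i (toℕ e) s≤e e<t)) (large⇒bottleneck< I k i (large i))

      -- The outer walls exclude nothing: both have top and bottom 0, the left one has end and peak
      -- column 0, and the right one starts at m with peak column m + 1, just beyond every end.
      between-walls : ∀ g → demand g ≤ T.b g → Fits n (n + 1) (toℕ g)
      between-walls g d≤b =
        ( subst (_≤ arrays σ₁ 1 (toℕ g)) (sym left) z≤n
        , subst (_≤ arrays σ₁ 8 (toℕ g)) (sym (proj₂ (floor n ≤-refl))) z≤n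
        , inj₁ (subst (_≤ arrays σ₁ 1 (toℕ g)) (sym tn≡0) z≤n)) ,
        ( subst₂ _<_ (sym tg≡) (sym (trans (proj₂ right) (+-comm m 1))) (s≤s (end≤m g))
        , subst (_≤ arrays σ₁ 8 (toℕ g)) (sym (proj₂ (floor (n + 1) (m≤m+n n 1)))) z≤n
        , inj₁ (subst₂ _≤_ (sym tg≡) (sym (proj₁ right)) (end≤m g))) ,
        subst₂ _≤_ (sym (Layout.d-task Λ g)) (sym (Layout.b-task Λ g)) d≤b
        where
        tg≡ : arrays σ₁ 2 (toℕ g) ≡ toℕ (end g)
        tg≡ = Layout.t-task Λ g
        tn≡0 : arrays σ₁ 2 n ≡ 0
        tn≡0 = trans (cong (λ f → f n) a₂≡) (zeroExtend-≥ (λ i → toℕ (end i)) ≤-refl)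

      gap : arrays σ₁ 6 (n + 1) ≤ arrays σ₁ 6 n + (m + 1)
      gap = ≤-trans (≤-reflexive (proj₂ right)) (m≤n+m (m + 1) (arrays σ₁ 6 n))

      disjoint-bound : ∀ {A} S → AllComplete (m + 1) A → (∀ g → S g ≡ true → demand g ≤ T.b g) →
        (∀ {i j} → S i ≡ true → S j ≡ true → i ≢ j → T.Disjoint i j) → sumOn S profit ≤ A (pairAt n (n + 1))
      disjoint-bound {A} S complete d≤b disjoint = conclude
        (plan-for (m + 1) {n} {n + 1} S gap (λ g Sg → between-walls g (d≤b g Sg)) disjoint profit)
        where
        conclude : (Σ (Plan n (n + 1)) λ P → height P ≤ m + 1 × sumOn S profit ≤ total profit P) → _
        conclude (P , height≤ , le) = ≤-trans le (complete n (n + 1) n<N n+1<N P height≤)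

      feasible-bound : ∀ {A} F → AllComplete (m + 1) A → Feasible I F → totalProfit I F ≤ 2 * k * A (pairAt n (n + 1))
      feasible-bound {A} F complete feasible = conclude
        (disjoint-subset (lookup F) packs k (λ i _ → top<demand i) profit)
        where
        packs : T.Packs (lookup F)
        packs = feasible⇒packs F feasible
        conclude : (∃[ S ] (∀ i → S i ≡ true → lookup F i ≡ true) ×
          (∀ {i j} → S i ≡ true → S j ≡ true → i ≢ j → T.Disjoint i j) ×
          sumOn (lookup F) profit ≤ 2 * k * sumOn S profit) → _
        conclude (S , S⊆F , disjoint , le) = ≤-trans le (*-monoʳ-≤ (2 * k)
          (disjoint-bound {A} S complete (λ g Sg → demand≤bottleneck (lookup F) packs g (S⊆F g Sg)) disjoint))

      -- Both halves meet at the entry for the outer walls: soundness equates it with the profit of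
      -- the published set, completeness compares it with the optimum.
      approximate : ∀ {σ σ′} → AfterRound (m + 1) σ → Publishing (arrays σ 10) n σ′ →
        IsApproximateSolution I (2 * k) (output n σ′)
      approximate {σ} {σ′} R K with AfterRound.sound R n (n + 1) n<N n+1<N
      ... | P , total≡ , member≡ = packs⇒feasible (output n σ′) (packs-cong (sym ∘ out≡) (plan-packs P)) ,
        λ { opt ((F , feasible , refl) , _) → ≤-trans (feasible-bound {arrays σ 9} F (AfterRound.complete R) feasible)
              (≤-reflexive (cong (2 * k *_) (trans total≡ (trans (total≡sumOn profit P) (sum-cong-≗ λ i → cong (λ z → if z then profit i else 0) (sym (out≡ i))))))) }
        where
        out≡ : ∀ i → lookup (output n σ′) i ≡ member P i
        out≡ i = trans (lookup∘tabulate _ i) (trans (cong nonzero (Publishing.published K (toℕ i) (toℕ<n i))) (member≡ i))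

      remainder-runs : Runs (strides ⨾ rounds ⨾ publish) σ₁ 4 (λ σ → IsApproximateSolution I (2 * k) (output n σ))
      remainder-runs =
        raise (s≤s z≤n) strides-run then λ Y →
        rounds-run (Ready.r₄≡ Y) m+1≤M (Ready.context Y) (proj₁ (Ready.zeros Y)) (proj₂ (Ready.zeros Y)) then λ A →
        consequence (approximate A) (raise (s≤s z≤n) (publish-runs (AfterRound.context A)))

  algorithm-runs : ∀ k .{{_ : NonZero k}} → (∀ i → Large I (+ 1 / k) i) →
    Runs algorithm (input I) 4 (λ σ → IsApproximateSolution I (2 * k) (output n σ))
  algorithm-runs k large =
    raise (s≤s (s≤s z≤n)) (peaks-run prepared) then λ R →
    raise z≤n (walls-run R) then λ {σ₁} W → Layed.remainder-runs σ₁ W k large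

^-distribʳ-* : ∀ k a b → (a * b) ^ k ≡ a ^ k * b ^ k
^-distribʳ-* zero    a b = refl
^-distribʳ-* (suc k) a b = trans (cong (a * b *_) (^-distribʳ-* k a b)) ([m*n]*[o*p]≡[m*o]*[n*p] a b (a ^ k) (b ^ k))

quartic-algorithm : ∀ {α 𝒞} P →
  (∀ I → 𝒞 I → Logic.Runs (3 * Instance.numTasks I) (Correctness.1≤M I) P (input I) 4
    (λ σ → IsApproximateSolution I α (output (Instance.numTasks I) σ))) →
  IsApproximationAlgorithm α 𝒞 (λ n → n ^ 4) P
quartic-algorithm P solve = factor P * 3 ^ 4 , λ I I∈𝒞 → let r = solve I I∈𝒞 in
  final r , time r , run r , ≤-trans (bounded r) (≤-reflexive (time≡ (Instance.numTasks I))) , post r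
  where
  open Logic
  time≡ : ∀ n → factor P * (3 * n) ^ 4 ≡ factor P * 3 ^ 4 * n ^ 4
  time≡ n = trans (cong (factor P *_) (^-distribʳ-* 4 3 n)) (sym (*-assoc (factor P) (3 ^ 4) (n ^ 4)))

theorem4p20 : (k : ℕ) .{{_ : NonZero k}} → 2 ≤ k →
    ∃[ P ] IsApproximationAlgorithm (2 * k) (λ I → ∀ i → Large I (+ 1 / k) i) (λ n → n ^ 4) P
theorem4p20 k _ = algorithm , quartic-algorithm {2 * k} {λ I → ∀ i → Large I (+ 1 / k) i} algorithm λ I → Correctness.algorithm-runs I k
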